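{- Consider the following algorithm, whose input is a hypergraph $H=(V,E)$ with $n=|V|$, $m=|E|$. Set $\mathrm{Core}:=V$. While $E\neq\emptyset$: let $F$ be the set of all edges containing a degree one vertex of the current hypergraph $(V,E)$; if $F=\emptyset$, return "no core of size $n-m$ possible"; otherwise, for each $e\in F$, choose a vertex $v\in e$ that has degree one in the current hypergraph $(V,E)$ and set $\mathrm{Core}:=\mathrm{Core}\setminus\{v\}$; after all $e\in F$ are processed, set $E:=E\setminus F$. When $E=\emptyset$, return $\mathrm{Core}$. Given a hypergraph $H$, this algorithm outputs a core of size $n-m$ with optimal (i.e. smallest possible among cores of size $n-m$) radius if and only if a core of size $n-m$ exists. Its runtime is $O(n\cdot m)$.
   Context: A hypergraph $H=(V,E)$ consists of a finite set $V$ (vertices) and a finite family $E$ of subsets of $V$ (edges). The degree of a vertex is the number of edges containing it. A core of $H$ is a set $C\subseteq V$ causing the following program to output $1$: (1) Remove all edges $e\in E$ with $e\subseteq C$. (2) While $E$ is non-empty: (a) if there exists $e\in E$ with $|e\cap C|=|e|-1$, set $C:=C\cup e$; (b) else return $0$; (c) remove all edges $e\in E$ with $e\cap C=e$. (3) Return $1$. In addition every vertex of $V$ has to lie in the final set $C$ (every vertex gets activated). The radius $r(C)$ of a core $C$ is the minimum $r$ such that $E$ can be subdivided into $r$ disjoint layers $L_1,\dots,L_r$ such that $|e\cap V_{i-1}|=|e|-1$ for all $e\in L_i$, where $V_i:=C\cup\bigcup_{j=1}^{i}V(L_j)$ and $V(L_j)$ is the union of the edges in $L_j$. -}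

module Defs where

open import Data.Bool.Base using (Bool; true; false; if_then_else_; _∧_; not)
import Data.Bool.Properties as Bool
open import Data.Fin.Base using (Fin; toℕ)
import Data.Fin.Properties as Fin
open import Data.Fin.Subset
open import Data.Fin.Subset.Properties using (_∈?_; _⊆?_)
open import Data.Integer.Base using (+_; _⊖_)
import Data.List.Base as List
open import Data.Maybe.Base using (Maybe; just; nothing)
open import Data.Nat.Base as ℕ using (ℕ; suc; pred; _+_; _≤_)
import Data.Nat.Properties as ℕ
open import Data.Product.Base using (_×_; _,_; ∃-syntax)
open import Data.Vec.Base using (lookup; tabulate)
open import Data.Vec.Properties using (≡-dec)
open import Induction.WellFounded using (Acc)
open import Function.Base using (flip)
open import Level using (0ℓ)
open import Relation.Binary.Construct.Closure.ReflexiveTransitive using (Star)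
open import Relation.Binary.Definitions using (DecidableEquality)
open import Relation.Binary.PropositionalEquality using (_≡_; refl)
open import Relation.Nullary.Decidable using (no; does; ¬?; map′; _×-dec_)
open import Relation.Unary using (Pred; Decidable)

private
  variable
    n m : ℕ

------------------------------------------------------------------------
-- Hypergraphs

-- A family of m edges on the vertex set Fin n.  Repeated edges and empty
-- edges are allowed.  Subsets of the edge family are represented as
-- subsets of the index set Fin m.

Hypergraph : ℕ → ℕ → Set
Hypergraph n m = Fin m → Subset n

⟪_⟫ : {k : ℕ} {P : Pred (Fin k) 0ℓ} → Decidable P → Subset k
⟪ P? ⟫ = tabulate λ x → does (P? x)

-- The degree of v in the hypergraph whose edges are those in E.

degree : Hypergraph n m → Subset m → Fin n → ℕ
degree H E v = ∣ E ∩ ⟪ (λ e → v ∈? H e) ⟫ ∣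

-- V(L), the union of the edges in L.

span : Hypergraph n m → Subset m → Subset n
span H L = ⟪ (λ v → Fin.any? λ e → (e ∈? L) ×-dec (v ∈? H e)) ⟫

-- |e ∩ C| = |e| - 1, which is false for the empty edge (truncated
-- subtraction would make it true).

OneMissing : Hypergraph n m → Subset n → Fin m → Set
OneMissing H C e = suc ∣ H e ∩ C ∣ ≡ ∣ H e ∣

------------------------------------------------------------------------
-- Cores

-- A state of the activation program: the edges not yet removed and the
-- current set C.

Activation : ℕ → ℕ → Set
Activation n m = Subset m × Subset n

activationStart : Hypergraph n m → Subset n → Activation n m
activationStart H C = ⟪ (λ e → ¬? (H e ⊆? C)) ⟫ , C

data _⊢_⇝_ (H : Hypergraph n m) : Activation n m → Activation n m → Set where
  activate : ∀ {E C} (e : Fin m) → e ∈ E → OneMissing H C e →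
    H ⊢ (E , C) ⇝
      ( E ∩ ⟪ (λ e′ → ¬? (≡-dec Bool._≟_ (H e′ ∩ (C ∪ H e)) (H e′))) ⟫
      , C ∪ H e
      )

-- The program outputs 1 and its final set is the whole vertex set.

IsCore : Hypergraph n m → Subset n → Set
IsCore H C = ∃[ E ] Empty E × Star (H ⊢_⇝_) (activationStart H C) (E , ⊤)

-- A core of size n - m, the difference being taken in ℤ.

IsCore[n-m] : Hypergraph n m → Subset n → Set
IsCore[n-m] {n} {m} H C = IsCore H C × + ∣ C ∣ ≡ n ⊖ m

-- The layers are indexed from 0, so for e in layer i the set in question
-- is the union of C and of all edges in layers j < i.

reached : ∀ {r} → Hypergraph n m → Subset n → (Fin m → Fin r) → ℕ → Subset n
reached H C layer i = C ∪ span H ⟪ (λ e → toℕ (layer e) ℕ.<? i) ⟫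

Layerable : Hypergraph n m → Subset n → ℕ → Set
Layerable {n} {m} H C r =
  ∃[ layer ] (∀ e → OneMissing H (reached {r = r} H C layer (toℕ (layer e))) e)

IsRadius : Hypergraph n m → Subset n → ℕ → Set
IsRadius H C r = Layerable H C r × (∀ r′ → Layerable H C r′ → r ≤ r′)

IsOptimalCore[n-m] : Hypergraph n m → Subset n → Set
IsOptimalCore[n-m] H C =
  IsCore[n-m] H C ×
  ∃[ r ] IsRadius H C r ×
         (∀ C′ r′ → IsCore[n-m] H C′ → IsRadius H C′ r′ → r ≤ r′)

------------------------------------------------------------------------
-- The algorithm

-- The current edge set and the current value of Core.

Config : ℕ → ℕ → Set
Config n m = Subset m × Subset n

-- The set F.

peelable : Hypergraph n m → Subset m → Subset m
peelable H E =
  ⟪ (λ e → (e ∈? E) ×-dec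
           Fin.any? λ v → (v ∈? H e) ×-dec (degree H E v ℕ.≟ 1)) ⟫

image : (Fin m → Fin n) → Subset m → Subset n
image f F = ⟪ (λ v → Fin.any? λ e → (e ∈? F) ×-dec (f e Fin.≟ v)) ⟫

-- One iteration of the loop, for an arbitrary choice of degree one
-- vertices.  The values of pick outside F are irrelevant, and the
-- condition E ≠ ∅ is implied by F ≠ ∅.

data _⊢_⟶_ (H : Hypergraph n m) : Config n m → Config n m → Set where
  round : ∀ {E Core} (pick : Fin m → Fin n) →
    Nonempty (peelable H E) →
    (∀ {e} → e ∈ peelable H E → pick e ∈ H e × degree H E (pick e) ≡ 1) →
    H ⊢ (E , Core) ⟶ (E ─ peelable H E , Core ─ image pick (peelable H E))

-- The result nothing is the answer "no core of size n - m possible".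

data _⊢_returns_ (H : Hypergraph n m) : Config n m → Maybe (Subset n) → Set where
  success : ∀ {E Core} → Empty E → H ⊢ (E , Core) returns just Core
  failure : ∀ {E Core} → Nonempty E → Empty (peelable H E) →
            H ⊢ (E , Core) returns nothing

Terminates : Hypergraph n m → Set
Terminates H = Acc (flip (H ⊢_⟶_)) (⊤ , ⊤)

Outputs : Hypergraph n m → Maybe (Subset n) → Set
Outputs H res = ∃[ K ] Star (H ⊢_⟶_) (⊤ , ⊤) K × H ⊢ K returns res

------------------------------------------------------------------------
-- A unit-cost imperative language

-- The memory consists of registers and of arrays indexed by vertices or
-- by edges, all numbered and all holding natural numbers.  The types V and
-- E of vertices and edges are parameters: a program polymorphic in them is
-- the same for all inputs and cannot compute with indices at no cost.

data Cell (V E : Set) : Set where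
  reg  : ℕ → Cell V E
  vArr : ℕ → V → Cell V E
  eArr : ℕ → E → Cell V E

infix  6 _≐_ _∋_
infix  5 _≔_
infixr 4 _∧ᵗ_
infix  3 when_then_ while_loop_
infixr 2 _⨾_

data Test (V E : Set) : Set where
  _≐_  : Cell V E → ℕ → Test V E
  _∋_  : E → V → Test V E
  ¬ᵗ_  : Test V E → Test V E
  _∧ᵗ_ : Test V E → Test V E → Test V E

data Cmd (V E : Set) : Set where
  skip      : Cmd V E
  _≔_       : Cell V E → ℕ → Cmd V E
  inc dec   : Cell V E → Cmd V E
  _⨾_       : Cmd V E → Cmd V E → Cmd V E
  when_then_    : Test V E → Cmd V E → Cmd V E
  while_loop_ : Test V E → Cmd V E → Cmd V E
  forV      : (V → Cmd V E) → Cmd V E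
  forE      : (E → Cmd V E) → Cmd V E

Memory : ℕ → ℕ → Set
Memory n m = Cell (Fin n) (Fin m) → ℕ

_≟ᶜ_ : DecidableEquality (Cell (Fin n) (Fin m))
reg i    ≟ᶜ reg j    = map′ (λ { refl → refl }) (λ { refl → refl }) (i ℕ.≟ j)
vArr i v ≟ᶜ vArr j w = map′ (λ { (refl , refl) → refl }) (λ { refl → refl , refl })
                            ((i ℕ.≟ j) ×-dec (v Fin.≟ w))
eArr i e ≟ᶜ eArr j f = map′ (λ { (refl , refl) → refl }) (λ { refl → refl , refl })
                            ((i ℕ.≟ j) ×-dec (e Fin.≟ f))
reg _    ≟ᶜ vArr _ _ = no λ ()
reg _    ≟ᶜ eArr _ _ = no λ ()
vArr _ _ ≟ᶜ reg _    = no λ ()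
vArr _ _ ≟ᶜ eArr _ _ = no λ ()
eArr _ _ ≟ᶜ reg _    = no λ ()
eArr _ _ ≟ᶜ vArr _ _ = no λ ()

_[_↦_] : Memory n m → Cell (Fin n) (Fin m) → ℕ → Memory n m
(σ [ x ↦ k ]) y = if does (x ≟ᶜ y) then k else σ y

-- The test e ∋ v reads one entry of the n × m incidence matrix, which is
-- how the hypergraph is given.

⟦_⟧ : Test (Fin n) (Fin m) → Hypergraph n m → Memory n m → Bool
⟦ x ≐ k ⟧  H σ = does (σ x ℕ.≟ k)
⟦ e ∋ v ⟧  H σ = lookup (H e) v
⟦ ¬ᵗ b ⟧   H σ = not (⟦ b ⟧ H σ)
⟦ b ∧ᵗ c ⟧ H σ = ⟦ b ⟧ H σ ∧ ⟦ c ⟧ H σ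

cost : ∀ {V E} → Test V E → ℕ
cost (_ ≐ _)  = 1
cost (_ ∋ _)  = 1
cost (¬ᵗ b)   = 1 + cost b
cost (b ∧ᵗ c) = 1 + cost b + cost c

unroll : ∀ {k V E} → (Fin k → Cmd V E) → Cmd V E
unroll c = List.foldr _⨾_ skip (List.tabulate c)

-- H ⊢ c , σ ⇓[ t ] σ′ means that, on input H and memory σ, the command c
-- halts after t elementary operations in memory σ′.

data _⊢_,_⇓[_]_ (H : Hypergraph n m) :
       Cmd (Fin n) (Fin m) → Memory n m → ℕ → Memory n m → Set where
  ⇓skip : ∀ {σ} → H ⊢ skip , σ ⇓[ 1 ] σ
  ⇓≔ : ∀ {σ x k} → H ⊢ x ≔ k , σ ⇓[ 1 ] (σ [ x ↦ k ])
  ⇓inc : ∀ {σ x} → H ⊢ inc x , σ ⇓[ 1 ] (σ [ x ↦ suc (σ x) ])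
  ⇓dec : ∀ {σ x} → H ⊢ dec x , σ ⇓[ 1 ] (σ [ x ↦ pred (σ x) ])
  ⇓⨾ : ∀ {σ σ′ σ″ c d s t} →
    H ⊢ c , σ ⇓[ s ] σ′ → H ⊢ d , σ′ ⇓[ t ] σ″ →
    H ⊢ c ⨾ d , σ ⇓[ 1 + s + t ] σ″
  ⇓when-true : ∀ {σ σ′ b c t} → ⟦ b ⟧ H σ ≡ true →
    H ⊢ c , σ ⇓[ t ] σ′ →
    H ⊢ when b then c , σ ⇓[ 1 + cost b + t ] σ′
  ⇓when-false : ∀ {σ b c} → ⟦ b ⟧ H σ ≡ false →
    H ⊢ when b then c , σ ⇓[ 1 + cost b ] σ
  ⇓while-true : ∀ {σ σ′ σ″ b c s t} → ⟦ b ⟧ H σ ≡ true →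
    H ⊢ c , σ ⇓[ s ] σ′ → H ⊢ while b loop c , σ′ ⇓[ t ] σ″ →
    H ⊢ while b loop c , σ ⇓[ 1 + cost b + s + t ] σ″
  ⇓while-false : ∀ {σ b c} → ⟦ b ⟧ H σ ≡ false →
    H ⊢ while b loop c , σ ⇓[ 1 + cost b ] σ
  ⇓forV : ∀ {σ σ′ c t} →
    H ⊢ unroll c , σ ⇓[ t ] σ′ → H ⊢ forV c , σ ⇓[ 1 + t ] σ′
  ⇓forE : ∀ {σ σ′ c t} →
    H ⊢ unroll c , σ ⇓[ t ] σ′ → H ⊢ forE c , σ ⇓[ 1 + t ] σ′

------------------------------------------------------------------------
-- The algorithm as a program

pattern stuck     = reg 0
pattern remaining = reg 1
pattern deg v     = vArr 0 v
pattern inCore v  = vArr 1 v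
pattern inE e     = eArr 0 e
pattern inF e     = eArr 1 e

private
  variable
    V E : Set

initialise : Cmd V E
initialise =
  stuck ≔ 0 ⨾
  remaining ≔ 0 ⨾
  forV (λ v → inCore v ≔ 1 ⨾ deg v ≔ 0) ⨾
  forE (λ e →
    inE e ≔ 1 ⨾
    inF e ≔ 0 ⨾
    inc remaining ⨾
    forV (λ v → when e ∋ v then inc (deg v)))

-- An edge enters F when its first degree one vertex is met, and that
-- vertex is the one removed from Core.  The flag stuck remains set
-- exactly when F = ∅.

buildF : Cmd V E
buildF =
  stuck ≔ 1 ⨾
  forV (λ v →
    when deg v ≐ 1 then
      forE (λ e →
        when inE e ≐ 1 ∧ᵗ e ∋ v ∧ᵗ inF e ≐ 0 then
          (inF e ≔ 1 ⨾ inCore v ≔ 0 ⨾ stuck ≔ 0)))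

deleteF : Cmd V E
deleteF =
  forE (λ e →
    when inF e ≐ 1 then
      ( inF e ≔ 0 ⨾
        inE e ≔ 0 ⨾
        dec remaining ⨾
        forV (λ v → when e ∋ v then dec (deg v))))

program : Cmd V E
program =
  initialise ⨾
  while (¬ᵗ (remaining ≐ 0)) ∧ᵗ stuck ≐ 0 loop (buildF ⨾ deleteF)

result : Memory n m → Maybe (Subset n)
result σ =
  if does (σ stuck ℕ.≟ 0)
  then just ⟪ (λ v → σ (inCore v) ℕ.≟ 1) ⟫
  else nothing

{-# OPTIONS --safe #-}
module Submission where

-- Peeling is activation backwards.  A core of size n - m amounts to a choice,
-- for every edge, of a pivot vertex which the edge alone contributes, in an
-- order such that a pivot occurs in no earlier edge.  The edges that are last
-- in such an order have degree one pivots, so each round of the algorithm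
-- strips at least the current last layer, whatever the core and its layering:
-- the algorithm does not get stuck and its number of rounds is at most the
-- radius.  Conversely its rounds, read backwards, layer the core it returns.

open import Defs
open import Data.Bool.Base using (Bool; true; false; if_then_else_; not; _∧_)
import Data.Bool.Properties as Bool
open import Data.Fin.Base using (Fin; zero; suc; toℕ; fromℕ<)
import Data.Fin.Properties as Fin
open import Data.Fin.Subset
open import Data.Fin.Subset.Properties
import Data.Integer.Base as ℤ
import Data.Integer.Properties as ℤ
open import Data.Maybe.Base using (Maybe; just; nothing; fromMaybe)
open import Data.Maybe.Properties using (just-injective)
open import Data.Nat.Base hiding (_⊔_; _⊓_; ∣_-_∣)
open import Data.Nat.Induction using (<-wellFounded)
open import Data.Nat.Properties
open import Data.Nat.Tactic.RingSolver using (solve-∀)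
open import Data.Product.Base using (_×_; _,_; ∃; ∃-syntax; proj₁; proj₂)
open import Data.Sum.Base using (_⊎_; inj₁; inj₂; [_,_]′)
open import Data.Vec.Base using (_∷_; []; here; there; lookup; tabulate; _[_]≔_)
open import Data.Vec.Properties
open import Function.Base using (_∘_; flip; id)
open import Function.Bundles using (_⇔_; mk⇔)
open import Induction.WellFounded using (Acc; acc)
open import Level using (0ℓ)
open import Relation.Binary.Construct.Closure.ReflexiveTransitive using (Star; ε; _◅_; _◅◅_)
open import Relation.Binary.PropositionalEquality
open import Relation.Nullary using (¬_; Dec; yes; no; does; contradiction)
open import Relation.Nullary.Decidable using (¬?; _×-dec_; dec-true; dec-false; decidable-stable)
open import Relation.Unary using (Pred; Decidable)

-- The size n - m matters because an activation adds exactly one vertex and discards at least one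
-- edge, so |E| + |C| never grows. A core of that size starts at n at most and has to end at n, so
-- there is no slack: no edge lies inside the core, and an activation discards only the activated
-- edge. Comparing radii needs a separate argument, since the order of an activation run says
-- nothing about the number of layers of a given layering. There the missing vertices of the m edges
-- cover the m vertices outside the core, and a surjection between finite sets of equal size is
-- injective. For the running time the obstacle is the number of rounds, as charging O(n m) to each
-- round would be too much. A round scans all edges only at vertices of degree one, and all vertices
-- only at peeled edges. Such a vertex lies in no remaining edge afterwards, and such an edge is
-- gone, so each of them is charged once in the whole run.

private
  variable
    a b n m r : ℕ

-- Finite subsets

∈⟪⟫⁺ : {P : Pred (Fin a) 0ℓ} (P? : Decidable P) {x : Fin a} → P x → x ∈ ⟪ P? ⟫
∈⟪⟫⁺ P? {x} px =
  lookup⇒[]= x _ (trans (lookup∘tabulate (does ∘ P?) x) (dec-true (P? x) px))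

∈⟪⟫⁻ : {P : Pred (Fin a) 0ℓ} (P? : Decidable P) {x : Fin a} → x ∈ ⟪ P? ⟫ → P x
∈⟪⟫⁻ P? {x} x∈ with P? x | trans (sym (lookup∘tabulate (does ∘ P?) x)) ([]=⇒lookup x∈)
... | yes px | _ = px
... | no _   | ()

x∈p─q⇒x∉q : (p q : Subset a) {x : Fin a} → x ∈ p ─ q → x ∉ q
x∈p─q⇒x∉q (_ ∷ p) (inside ∷ q)  (there x∈) (there x∈q) = x∈p─q⇒x∉q p q x∈ x∈q
x∈p─q⇒x∉q (_ ∷ p) (outside ∷ q) (there x∈) (there x∈q) = x∈p─q⇒x∉q p q x∈ x∈q

x∉p-x : (p : Subset a) (x : Fin a) → x ∉ p - x
x∉p-x p x x∈ = x∈p─q⇒x∉q p ⁅ x ⁆ x∈ (x∈⁅x⁆ x)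

x∈p⇒∣p∣≡1+∣p-x∣ : {p : Subset a} {x : Fin a} → x ∈ p → ∣ p ∣ ≡ suc ∣ p - x ∣
x∈p⇒∣p∣≡1+∣p-x∣ {p = inside ∷ p}  here       = cong (suc ∘ ∣_∣) (sym (p─⊥≡p p))
x∈p⇒∣p∣≡1+∣p-x∣ {p = inside ∷ p}  (there x∈) = cong suc (x∈p⇒∣p∣≡1+∣p-x∣ x∈)
x∈p⇒∣p∣≡1+∣p-x∣ {p = outside ∷ p} (there x∈) = x∈p⇒∣p∣≡1+∣p-x∣ x∈

x∈p⇒0<∣p∣ : {p : Subset a} {x : Fin a} → x ∈ p → 0 < ∣ p ∣
x∈p⇒0<∣p∣ x∈ = ≤-<-trans z≤n (x∈p⇒∣p-x∣<∣p∣ x∈)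

-- Used to exclude a second exception where cardinalities leave room for one: a second missing
-- vertex of an edge, or a second edge lost in one activation.
∣q∣+2≤∣p∣ : {p q : Subset a} {x y : Fin a} → x ∈ p → y ∈ p → y ≢ x →
            q ⊆ p → x ∉ q → y ∉ q → suc (suc ∣ q ∣) ≤ ∣ p ∣
∣q∣+2≤∣p∣ {p = p} {q} {x} {y} x∈p y∈p y≢x q⊆p x∉q y∉q =
  ≤-<-trans (≤-<-trans (p⊆q⇒∣p∣≤∣q∣ q⊆) (x∈p⇒∣p-x∣<∣p∣ (x∈p∧x≢y⇒x∈p-y y∈p y≢x)))
            (x∈p⇒∣p-x∣<∣p∣ x∈p)
  where
  q⊆ : q ⊆ p - x - y
  q⊆ z∈q = x∈p∧x≢y⇒x∈p-y (x∈p∧x≢y⇒x∈p-y (q⊆p z∈q) (λ { refl → x∉q z∈q }))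
                          (λ { refl → y∉q z∈q })

-- The injection is given as a relation, so that "`v` is the pivot of `e`" can serve in both
-- directions, from edges to vertices and from vertices to edges. Removing the partner of each
-- element from `q` keeps the induction going.
∣∣-injection : (p : Subset a) (q : Subset b) (R : Fin a → Fin b → Set) →
  (∀ {i} → i ∈ p → ∃[ j ] j ∈ q × R i j) →
  (∀ {i i′ j} → R i j → R i′ j → i ≡ i′) → ∣ p ∣ ≤ ∣ q ∣
∣∣-injection []            q R f inj = z≤n
∣∣-injection (outside ∷ p) q R f inj =
  ∣∣-injection p q (R ∘ suc) (f ∘ there) (λ r s → Fin.suc-injective (inj r s))
∣∣-injection (inside ∷ p)  q R f inj with f here
... | j , j∈q , r =
  ≤-trans (s≤s (∣∣-injection p (q - j) (R ∘ suc) f′ (λ r s → Fin.suc-injective (inj r s))))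
          (x∈p⇒∣p-x∣<∣p∣ j∈q)
  where
  f′ : ∀ {i} → i ∈ p → ∃[ k ] k ∈ q - j × R (suc i) k
  f′ i∈p with f (there i∈p)
  ... | k , k∈q , s =
    k , x∈p∧x≢y⇒x∈p-y k∈q (λ { refl → Fin.0≢1+n (inj r s) }) , s

argmin : (f : Fin a → ℕ) {P : Pred (Fin a) 0ℓ} → Decidable P → ∃[ x ] P x →
         ∃[ x ] P x × (∀ {y} → P y → f x ≤ f y)
argmin f {P} P? (x , px) = go x px (<-wellFounded (f x))
  where
  go : ∀ x → P x → Acc _<_ (f x) → ∃[ x ] P x × (∀ {y} → P y → f x ≤ f y)
  go x px (acc rs) with Fin.any? (λ y → P? y ×-dec (f y <? f x))
  ... | yes (y , py , y<x) = go y py (rs y<x)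
  ... | no ∄y = x , px , λ {y} py → ≮⇒≥ (λ y<x → ∄y (y , py , y<x))

∣p─q∣<∣p∣ : {p q : Subset a} → q ⊆ p → Nonempty q → ∣ p ─ q ∣ < ∣ p ∣
∣p─q∣<∣p∣ {p = p} {q} q⊆p (x , x∈q) = p∩q≢∅⇒∣p─q∣<∣p∣ p q (x , x∈p∩q⁺ (q⊆p x∈q , x∈q))

-- Missing vertices and degrees

module _ {p q : Subset a} where

  missing⁺ : ∀ {v} → v ∈ p → v ∉ q → (∀ {w} → w ∈ p → w ≢ v → w ∈ q) →
             suc ∣ p ∩ q ∣ ≡ ∣ p ∣
  missing⁺ {v} v∈p v∉q rest = begin
    suc ∣ p ∩ q ∣ ≡⟨ cong (suc ∘ ∣_∣) (⊆-antisym p∩q⊆p-v p-v⊆p∩q) ⟩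
    suc ∣ p - v ∣ ≡⟨ x∈p⇒∣p∣≡1+∣p-x∣ v∈p ⟨
    ∣ p ∣         ∎
    where
    open ≡-Reasoning
    p∩q⊆p-v : p ∩ q ⊆ p - v
    p∩q⊆p-v w∈ with w∈p , w∈q ← x∈p∩q⁻ p q w∈ =
      x∈p∧x≢y⇒x∈p-y w∈p (λ { refl → v∉q w∈q })
    p-v⊆p∩q : p - v ⊆ p ∩ q
    p-v⊆p∩q w∈ = x∈p∩q⁺ (w∈p , rest w∈p (λ { refl → x∉p-x p v w∈ }))
      where w∈p = p─q⊆p p ⁅ v ⁆ w∈

  -- Turns the cardinality condition `OneMissing` into an actual vertex, from which pivots are made.
  missing⁻ : suc ∣ p ∩ q ∣ ≡ ∣ p ∣ →
             ∃[ v ] v ∈ p × v ∉ q × (∀ {w} → w ∈ p → w ∉ q → w ≡ v)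
  missing⁻ eq with Fin.any? (λ v → (v ∈? p) ×-dec ¬? (v ∈? q))
  ... | no ∄v = contradiction (≤-trans (≤-reflexive eq) (p⊆q⇒∣p∣≤∣q∣ p⊆p∩q)) 1+n≰n
    where
    p⊆p∩q : p ⊆ p ∩ q
    p⊆p∩q {v} v∈p =
      x∈p∩q⁺ (v∈p , decidable-stable (v ∈? q) (λ v∉q → ∄v (v , v∈p , v∉q)))
  ... | yes (v , v∈p , v∉q) = v , v∈p , v∉q , unique
    where
    unique : ∀ {w} → w ∈ p → w ∉ q → w ≡ v
    unique {w} w∈p w∉q = decidable-stable (w Fin.≟ v) λ w≢v →
      1+n≰n (≤-trans (∣q∣+2≤∣p∣ v∈p w∈p w≢v (p∩q⊆p p q)
                        (v∉q ∘ proj₂ ∘ x∈p∩q⁻ p q) (w∉q ∘ proj₂ ∘ x∈p∩q⁻ p q))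
                     (≤-reflexive (sym eq)))

module _ (H : Hypergraph n m) where

  incident⁺ : ∀ {E v e} → e ∈ E → v ∈ H e → e ∈ E ∩ ⟪ (λ e → v ∈? H e) ⟫
  incident⁺ {v = v} e∈E v∈e = x∈p∩q⁺ (e∈E , ∈⟪⟫⁺ (λ e → v ∈? H e) v∈e)

  incident⁻ : ∀ {E v e} → e ∈ E ∩ ⟪ (λ e → v ∈? H e) ⟫ → e ∈ E × v ∈ H e
  incident⁻ {E} {v} e∈ with e∈E , e∈S ← x∈p∩q⁻ E _ e∈ =
    e∈E , ∈⟪⟫⁻ (λ e → v ∈? H e) e∈S

  degree≡1⁺ : ∀ {E v e} → e ∈ E → v ∈ H e →
              (∀ {e′} → e′ ∈ E → v ∈ H e′ → e′ ≡ e) → degree H E v ≡ 1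
  degree≡1⁺ {E} {v} {e} e∈E v∈e unique =
    trans (cong ∣_∣ (⊆-antisym ⊆⁅e⁆ ⁅e⁆⊆)) (∣⁅x⁆∣≡1 e)
    where
    ⊆⁅e⁆ : E ∩ ⟪ (λ e → v ∈? H e) ⟫ ⊆ ⁅ e ⁆
    ⊆⁅e⁆ e′∈ with e′∈E , v∈e′ ← incident⁻ e′∈ with refl ← unique e′∈E v∈e′ = x∈⁅x⁆ e
    ⁅e⁆⊆ : ⁅ e ⁆ ⊆ E ∩ ⟪ (λ e → v ∈? H e) ⟫
    ⁅e⁆⊆ e′∈ with refl ← x∈⁅y⁆⇒x≡y e e′∈ = incident⁺ e∈E v∈e

  degree≡1⁻ : ∀ {E v e e′} → degree H E v ≡ 1 → e ∈ E → v ∈ H e →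
              e′ ∈ E → v ∈ H e′ → e ≡ e′
  degree≡1⁻ {E} {v} {e} {e′} eq e∈E v∈e e′∈E v∈e′ =
    decidable-stable (e Fin.≟ e′) λ e≢e′ →
      <-irrefl refl (<-≤-trans
        (x∈p⇒0<∣p∣ (x∈p∧x≢y⇒x∈p-y (incident⁺ e∈E v∈e) e≢e′))
        (s≤s⁻¹ (≤-trans (x∈p⇒∣p-x∣<∣p∣ (incident⁺ e′∈E v∈e′)) (≤-reflexive eq))))

  private
    peelable? : ∀ E → Decidable (λ e → e ∈ E × ∃[ v ] v ∈ H e × degree H E v ≡ 1)
    peelable? E e = (e ∈? E) ×-dec
                    Fin.any? (λ v → (v ∈? H e) ×-dec (degree H E v ≟ 1))

  peelable⁺ : ∀ {E e v} → e ∈ E → v ∈ H e → degree H E v ≡ 1 → e ∈ peelable H E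
  peelable⁺ {E} e∈E v∈e eq = ∈⟪⟫⁺ (peelable? E) (e∈E , _ , v∈e , eq)

  peelable⁻ : ∀ {E e} → e ∈ peelable H E → e ∈ E × ∃[ v ] v ∈ H e × degree H E v ≡ 1
  peelable⁻ {E} = ∈⟪⟫⁻ (peelable? E)

  peelable⊆ : ∀ {E} → peelable H E ⊆ E
  peelable⊆ = proj₁ ∘ peelable⁻

image⁺ : (f : Fin m → Fin n) {F : Subset m} {e : Fin m} → e ∈ F → f e ∈ image f F
image⁺ f {F} e∈F =
  ∈⟪⟫⁺ (λ v → Fin.any? λ e → (e ∈? F) ×-dec (f e Fin.≟ v)) (_ , e∈F , refl)

image⁻ : (f : Fin m → Fin n) {F : Subset m} {v : Fin n} → v ∈ image f F →
         ∃[ e ] e ∈ F × f e ≡ v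
image⁻ f {F} = ∈⟪⟫⁻ (λ v → Fin.any? λ e → (e ∈? F) ×-dec (f e Fin.≟ v))

-- Eliminations

-- An order in which the edges of E can be activated, each edge adding exactly
-- its pivot: a pivot may only recur in edges of strictly later time.
record Elimination (H : Hypergraph n m) (E : Subset m) (r : ℕ) : Set where
  field
    time   : Fin m → ℕ
    pivot  : Fin m → Fin n
    time<  : ∀ {e} → e ∈ E → time e < r
    pivot∈ : ∀ {e} → e ∈ E → pivot e ∈ H e
    later  : ∀ {e e′} → e ∈ E → e′ ∈ E → pivot e ∈ H e′ → e ≡ e′ ⊎ time e < time e′

open Elimination

module _ {H : Hypergraph n m} where

  -- The time bound is supplied afresh because it may shrink: once the edges of the last time are
  -- gone, the same order is an elimination with a smaller bound.
  restrict : ∀ {E E′} → E′ ⊆ E → (l : Elimination H E r) →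
             (∀ {e} → e ∈ E′ → time l e < a) → Elimination H E′ a
  restrict E′⊆E l bound = record
    { time = time l ; pivot = pivot l ; time< = bound
    ; pivot∈ = pivot∈ l ∘ E′⊆E
    ; later = λ e∈ e′∈ → later l (E′⊆E e∈) (E′⊆E e′∈) }

  pivot-injective : ∀ {E} (l : Elimination H E r) {e e′} → e ∈ E → e′ ∈ E →
                    pivot l e ≡ pivot l e′ → e ≡ e′
  pivot-injective l e∈ e′∈ eq
    with later l e∈ e′∈ (subst (_∈ H _) (sym eq) (pivot∈ l e′∈))
       | later l e′∈ e∈ (subst (_∈ H _) eq (pivot∈ l e∈))
  ... | inj₁ e≡e′ | _         = e≡e′
  ... | inj₂ _    | inj₁ e′≡e = sym e′≡e
  ... | inj₂ lt   | inj₂ gt   = contradiction gt (<-asym lt)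

  time<⊎peelable : ∀ {E e} (l : Elimination H E (suc r)) → e ∈ E →
                   time l e < r ⊎ e ∈ peelable H E
  time<⊎peelable {r = r} {E = E} {e} l e∈E with time l e <? r
  ... | yes lt = inj₁ lt
  ... | no ≮r = inj₂ (peelable⁺ H e∈E (pivot∈ l e∈E) (degree≡1⁺ H e∈E (pivot∈ l e∈E) unique))
    where
    unique : ∀ {e′} → e′ ∈ E → pivot l e ∈ H e′ → e′ ≡ e
    unique e′∈E p∈ with later l e∈E e′∈E p∈
    ... | inj₁ e≡e′ = sym e≡e′
    ... | inj₂ lt = contradiction (<-≤-trans lt (s≤s⁻¹ (time< l e′∈E))) ≮r

  peel : ∀ {E} → Elimination H E (suc r) → Elimination H (E ─ peelable H E) r
  peel {E = E} l = restrict (p─q⊆p E _) l λ e∈ →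
    [ id , (λ e∈F → contradiction e∈F (x∈p─q⇒x∉q E _ e∈)) ]′
      (time<⊎peelable l (p─q⊆p E _ e∈))

  -- With nothing peelable, no edge of `E` can have the last possible time. The bound therefore
  -- drops step by step to 0, where no edge is left.
  not-stuck : ∀ {E} → Elimination H E r → Empty (peelable H E) → Empty E
  not-stuck {r = zero}  l ∄F (e , e∈E) = n≮0 (time< l e∈E)
  not-stuck {r = suc r} l ∄F = not-stuck
    (restrict id l λ e∈ →
      [ id , (λ e∈F → contradiction (_ , e∈F) ∄F) ]′ (time<⊎peelable l e∈)) ∄F

  rounds : ∀ {K K′} → Star (H ⊢_⟶_) K K′ → ℕ
  rounds ε       = 0
  rounds (_ ◅ s) = suc (rounds s)

  -- Each round uses up one unit of the time bound, and a round needs a nonempty `E`. The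
  -- elimination is unrelated to the choices made in the run, so it may come from any competing
  -- core.
  rounds≤ : ∀ {K K′} → Elimination H (proj₁ K) r → (s : Star (H ⊢_⟶_) K K′) → rounds s ≤ r
  rounds≤ l ε = z≤n
  rounds≤ {r = zero}  l (round pick (e , e∈F) _ ◅ s) =
    contradiction (time< l (peelable⊆ H e∈F)) n≮0
  rounds≤ {r = suc r} l (round pick _ _ ◅ s) = s≤s (rounds≤ (peel l) s)

  run-⊆ : ∀ {K K′} → Star (H ⊢_⟶_) K K′ → proj₁ K′ ⊆ proj₁ K
  run-⊆ ε = id
  run-⊆ (round {E = E} _ _ _ ◅ s) = p─q⊆p E _ ∘ run-⊆ s

  Acc-⟶ : ∀ {K} → Acc _<_ ∣ proj₁ K ∣ → Acc (flip (H ⊢_⟶_)) K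
  Acc-⟶ (acc rs) = acc λ where
    (round {E = E} _ F≢∅ _) → Acc-⟶ (rs (∣p─q∣<∣p∣ (peelable⊆ H) F≢∅))

  -- The time of an edge counts rounds backwards from the end of the run.
  run⇒elimination : ∀ {K K′} → (Fin m → Fin n) → (s : Star (H ⊢_⟶_) K K′) →
    Empty (proj₁ K′) → ∃ λ (l : Elimination H (proj₁ K) (rounds s)) →
    proj₂ K′ ≡ proj₂ K ─ image (pivot l) (proj₁ K)
  run⇒elimination {_ , C} pivot₀ ε ∄E =
    -- `pivot` is a total function, so edges outside `E` need some vertex too; here that is every
    -- edge, and the image over the empty set removes nothing from the core.
    record { time = λ _ → 0 ; pivot = pivot₀
           ; time< = λ e∈ → contradiction (_ , e∈) ∄E
           ; pivot∈ = λ e∈ → contradiction (_ , e∈) ∄E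
           ; later = λ e∈ → contradiction (_ , e∈) ∄E } ,
    ⊆-antisym (λ v∈ → x∈p∧x∉q⇒x∈p─q v∈ λ v∈i → ∄E (_ , proj₁ (proj₂ (image⁻ pivot₀ v∈i))))
              (p─q⊆p C _)
  run⇒elimination {E , C} {_ , C′} pivot₀ (round pick F≢∅ picks ◅ s) ∄E
    with l , eq ← run⇒elimination pivot₀ s ∄E =
    l′ , ⊆-antisym to from
    where
    F = peelable H E
    time′ : Fin m → ℕ
    time′ e = if does (e ∈? F) then rounds s else time l e
    pivot′ : Fin m → Fin n
    pivot′ e = if does (e ∈? F) then pick e else pivot l e
    ∈E─F : ∀ {e} → e ∈ E → e ∉ F → e ∈ E ─ F
    ∈E─F = x∈p∧x∉q⇒x∈p─q
    time′< : ∀ {e} → e ∈ E → time′ e < suc (rounds s)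
    time′< {e} e∈E with e ∈? F
    ... | yes _  = ≤-refl
    ... | no e∉F = m≤n⇒m≤1+n (time< l (∈E─F e∈E e∉F))
    pivot′∈ : ∀ {e} → e ∈ E → pivot′ e ∈ H e
    pivot′∈ {e} e∈E with e ∈? F
    ... | yes e∈F = proj₁ (picks e∈F)
    ... | no e∉F  = pivot∈ l (∈E─F e∈E e∉F)
    later′ : ∀ {e e′} → e ∈ E → e′ ∈ E → pivot′ e ∈ H e′ → e ≡ e′ ⊎ time′ e < time′ e′
    later′ {e} {e′} e∈E e′∈E p∈ with e ∈? F | e′ ∈? F
    ... | yes e∈F | _ =
      inj₁ (degree≡1⁻ H (proj₂ (picks e∈F)) e∈E (proj₁ (picks e∈F)) e′∈E p∈)
    ... | no e∉F | yes _    = inj₂ (time< l (∈E─F e∈E e∉F))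
    ... | no e∉F | no e′∉F  = later l (∈E─F e∈E e∉F) (∈E─F e′∈E e′∉F) p∈
    l′ : Elimination H E (suc (rounds s))
    l′ = record { time = time′ ; pivot = pivot′ ; time< = time′<
                ; pivot∈ = pivot′∈ ; later = later′ }
    to : C′ ⊆ C ─ image pivot′ E
    to {v} v∈C′ = x∈p∧x∉q⇒x∈p─q (p─q⊆p C _ v∈₁) λ v∈i → absurd (image⁻ pivot′ v∈i)
      where
      v∈ = subst (v ∈_) eq v∈C′
      v∈₁ = p─q⊆p (C ─ image pick F) _ v∈
      absurd : ¬ (∃[ e ] e ∈ E × pivot′ e ≡ v)
      absurd (e , e∈E , p≡v) with e ∈? F
      ... | yes e∈F = x∈p─q⇒x∉q C _ v∈₁ (subst (_∈ image pick F) p≡v (image⁺ pick e∈F))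
      ... | no e∉F = x∈p─q⇒x∉q (C ─ image pick F) _ v∈
        (subst (_∈ image (pivot l) (E ─ F)) p≡v (image⁺ (pivot l) (∈E─F e∈E e∉F)))
    from : C ─ image pivot′ E ⊆ C′
    from {v} v∈ = subst (v ∈_) (sym eq)
      (x∈p∧x∉q⇒x∈p─q (x∈p∧x∉q⇒x∈p─q (p─q⊆p C _ v∈) (v∉ ∘ case₁ ∘ image⁻ pick))
                     (v∉ ∘ case₂ ∘ image⁻ (pivot l)))
      where
      v∉ = x∈p─q⇒x∉q C _ v∈
      case₁ : ∃[ e ] e ∈ F × pick e ≡ v → v ∈ image pivot′ E
      case₁ (e , e∈F , refl) = subst (_∈ image pivot′ E) p≡ (image⁺ pivot′ (peelable⊆ H e∈F))
        where
        p≡ : pivot′ e ≡ pick e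
        p≡ rewrite dec-true (e ∈? F) e∈F = refl
      case₂ : ∃[ e ] e ∈ E ─ F × pivot l e ≡ v → v ∈ image pivot′ E
      case₂ (e , e∈ , refl) = subst (_∈ image pivot′ E) p≡ (image⁺ pivot′ (p─q⊆p E _ e∈))
        where
        p≡ : pivot′ e ≡ pivot l e
        p≡ with e ∈? F
        ... | yes e∈F = contradiction e∈F (x∈p─q⇒x∉q E _ e∈)
        ... | no _ = refl

-- From eliminations to cores

module _ (H : Hypergraph n m) where

  survives? : (C : Subset n) (e : Fin m) → Decidable (λ e′ → H e′ ∩ (C ∪ H e) ≢ H e′)
  survives? C e e′ = ¬? (≡-dec Bool._≟_ (H e′ ∩ (C ∪ H e)) (H e′))

  survivors⊈ : ∀ E C e {e′} → e′ ∈ E ∩ ⟪ survives? C e ⟫ → ¬ (H e′ ⊆ C ∪ H e)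
  survivors⊈ E C e {e′} e′∈ ⊆C = ∈⟪⟫⁻ (survives? C e) (proj₂ (x∈p∩q⁻ E _ e′∈))
    (⊆-antisym (p∩q⊆p (H e′) _) (λ w∈ → x∈p∩q⁺ (w∈ , ⊆C w∈)))

  ∣survivors∣< : ∀ E C e → e ∈ E → ∣ E ∩ ⟪ survives? C e ⟫ ∣ < ∣ E ∣
  ∣survivors∣< E C e e∈E =
    p⊂q⇒∣p∣<∣q∣ (p∩q⊆p E _ , e , e∈E , λ e∈ → survivors⊈ E C e e∈ (q⊆p∪q C (H e)))

  
module _ (H : Hypergraph n m) (C : Subset n) (layer : Fin m → Fin r) where

  private
    lower? : (i : ℕ) → Decidable (λ e → toℕ (layer e) < i)
    lower? i e = toℕ (layer e) <? i

    spanned? : (i : ℕ) → Decidable (λ v → ∃[ e ] e ∈ ⟪ lower? i ⟫ × v ∈ H e)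
    spanned? i v = Fin.any? λ e → (e ∈? ⟪ lower? i ⟫) ×-dec (v ∈? H e)

  core⊆reached : ∀ i → C ⊆ reached H C layer i
  core⊆reached i = p⊆p∪q _

  edge⊆reached : ∀ {i e} → toℕ (layer e) < i → H e ⊆ reached H C layer i
  edge⊆reached {i} e<i v∈ =
    q⊆p∪q C _ (∈⟪⟫⁺ (spanned? i) (_ , ∈⟪⟫⁺ (lower? i) e<i , v∈))

  reached⁻ : ∀ {i v} → v ∈ reached H C layer i →
             v ∈ C ⊎ ∃[ e ] toℕ (layer e) < i × v ∈ H e
  reached⁻ {i} v∈ with x∈p∪q⁻ C _ v∈
  ... | inj₁ v∈C = inj₁ v∈C
  ... | inj₂ v∈s with e , e∈ , v∈e ← ∈⟪⟫⁻ (spanned? i) v∈s =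
    inj₂ (e , ∈⟪⟫⁻ (lower? i) e∈ , v∈e)

module _ {H : Hypergraph n m} (l : Elimination H ⊤ r) {C : Subset n}
         (C≡ : C ≡ ⊤ ─ image (pivot l) ⊤) where

  private
    pivot∉C : ∀ e → pivot l e ∉ C
    pivot∉C e p∈ = x∈p─q⇒x∉q ⊤ _ (subst (_ ∈_) C≡ p∈) (image⁺ (pivot l) ∈⊤)

    pivot⊎C : ∀ v → (∃[ e ] pivot l e ≡ v) ⊎ v ∈ C
    pivot⊎C v with v ∈? image (pivot l) ⊤
    ... | yes v∈ with e , _ , p≡v ← image⁻ (pivot l) v∈ = inj₁ (e , p≡v)
    ... | no v∉ = inj₂ (subst (v ∈_) (sym C≡) (x∈p∧x∉q⇒x∈p─q ∈⊤ v∉))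

  -- Times serve as layers. The pivot of an edge is not reached before it, because other edges
  -- containing this pivot come strictly later; any other vertex of the edge is in `C` or is the
  -- pivot of a strictly earlier edge.
  elimination⇒layerable : Layerable H C r
  elimination⇒layerable = layer , λ e →
    missing⁺ (pivot∈ l ∈⊤) (pivot∉ e) (others e)
    where
    layer : Fin m → Fin r
    layer e = fromℕ< (time< l (∈⊤ {x = e}))
    toℕ-layer : ∀ e → toℕ (layer e) ≡ time l e
    toℕ-layer e = Fin.toℕ-fromℕ< (time< l ∈⊤)
    pivot∉ : ∀ e → pivot l e ∉ reached H C layer (toℕ (layer e))
    pivot∉ e p∈ with reached⁻ H C layer {toℕ (layer e)} p∈
    ... | inj₁ p∈C = pivot∉C e p∈C
    ... | inj₂ (e′ , e′<e , p∈e′)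
      with later l {e} {e′} ∈⊤ ∈⊤ p∈e′ | subst₂ _<_ (toℕ-layer e′) (toℕ-layer e) e′<e
    ... | inj₁ refl | lt = <-irrefl refl lt
    ... | inj₂ gt   | lt = <-asym lt gt
    others : ∀ e {w} → w ∈ H e → w ≢ pivot l e → w ∈ reached H C layer (toℕ (layer e))
    others e {w} w∈e w≢p with pivot⊎C w
    ... | inj₂ w∈C = core⊆reached H C layer (toℕ (layer e)) w∈C
    ... | inj₁ (e′ , refl) with later l {e′} {e} ∈⊤ ∈⊤ w∈e
    ... | inj₁ refl = contradiction refl w≢p
    ... | inj₂ lt = edge⊆reached H C layer {e = e′}
      (subst₂ _<_ (sym (toℕ-layer e′)) (sym (toℕ-layer e)) lt) (pivot∈ l ∈⊤)

  -- The program is nondeterministic, so a run has to be exhibited: always activate the open edge of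
  -- least time. Its other vertices are in `C` or are pivots of earlier edges, which lie inside `D`
  -- already; its pivot is outside `D`, or the edge would not be open. The two hypotheses on `E`
  -- keep it equal to the set of edges not inside `D`.
  elimination⇒core : IsCore H C
  elimination⇒core = go _ C id (∈⟪⟫⁻ open?) (∈⟪⟫⁺ open?) (<-wellFounded _)
    where
    open? : Decidable (λ e → ¬ (H e ⊆ C))
    open? e = ¬? (H e ⊆? C)
    go : ∀ E D → C ⊆ D → (∀ {e} → e ∈ E → ¬ (H e ⊆ D)) → (∀ {e} → ¬ (H e ⊆ D) → e ∈ E) →
         Acc _<_ ∣ E ∣ → ∃[ E′ ] Empty E′ × Star (H ⊢_⇝_) (E , D) (E′ , ⊤)
    go E D C⊆D E⇒ ⇒E (acc rs) with nonempty? E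
    ... | no ∄E = E , ∄E , subst (λ X → Star (H ⊢_⇝_) (E , D) (E , X)) D≡⊤ ε
      where
      D≡⊤ : D ≡ ⊤
      D≡⊤ = ⊆-antisym ⊆⊤ λ {v} _ → [ (λ { (e , refl) →
        decidable-stable (H e ⊆? D) (λ ⊈ → ∄E (e , ⇒E ⊈)) (pivot∈ l ∈⊤) }) , C⊆D ]′ (pivot⊎C v)
    ... | yes E≢∅ with e , e∈E , e-min ← argmin (time l) (_∈? E) E≢∅ =
      let E″ , ∄E″ , s = go E₁ (D ∪ H e) (p⊆p∪q _ ∘ C⊆D)
                          (survivors⊈ H E D e) ⇒E₁ (rs (∣survivors∣< H E D e e∈E))
      in E″ , ∄E″ , activate e e∈E (missing⁺ (pivot∈ l ∈⊤) p∉D others) ◅ s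
      where
      others : ∀ {w} → w ∈ H e → w ≢ pivot l e → w ∈ D
      others {w} w∈e w≢p with pivot⊎C w
      ... | inj₂ w∈C = C⊆D w∈C
      ... | inj₁ (e′ , refl) with later l {e′} {e} ∈⊤ ∈⊤ w∈e
      ... | inj₁ refl = contradiction refl w≢p
      ... | inj₂ lt = decidable-stable (H e′ ⊆? D)
        (λ ⊈ → <⇒≱ lt (e-min (⇒E ⊈))) (pivot∈ l ∈⊤)
      p∉D : pivot l e ∉ D
      p∉D p∈D = E⇒ e∈E e⊆D
        where
        e⊆D : H e ⊆ D
        e⊆D {w} w∈e with w Fin.≟ pivot l e
        ... | yes refl = p∈D
        ... | no w≢p = others w∈e w≢p
      E₁ = E ∩ ⟪ survives? H D e ⟫
      ⇒E₁ : ∀ {e′} → ¬ (H e′ ⊆ D ∪ H e) → e′ ∈ E₁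
      ⇒E₁ {e′} ⊈ = x∈p∩q⁺ (⇒E (λ ⊆D → ⊈ (λ w∈ → p⊆p∪q _ (⊆D w∈))) ,
        ∈⟪⟫⁺ (survives? H D e)
             (λ eq → ⊈ (λ w∈ → proj₂ (x∈p∩q⁻ (H e′) _ (subst (_ ∈_) (sym eq) w∈)))))

  -- Pivots match the edges bijectively with the vertices outside `C`. This also gives m ≤ n, so
  -- that the integer difference is the natural one.
  elimination⇒size : ℤ.+ ∣ C ∣ ≡ n ℤ.⊖ m
  elimination⇒size = begin
    ℤ.+ ∣ C ∣           ≡⟨ cong ℤ.+_ (m∸[m∸n]≡n (∣p∣≤n C)) ⟨
    ℤ.+ (n ∸ (n ∸ ∣ C ∣)) ≡⟨ cong (λ k → ℤ.+ (n ∸ k)) (trans (sym (∣∁p∣≡n∸∣p∣ C)) ∣∁C∣≡m) ⟩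
    ℤ.+ (n ∸ m)         ≡⟨ ℤ.⊖-≥ (subst (_≤ n) ∣∁C∣≡m (∣p∣≤n (∁ C))) ⟨
    n ℤ.⊖ m             ∎
    where
    open ≡-Reasoning
    ∣∁C∣≡m : ∣ ∁ C ∣ ≡ m
    ∣∁C∣≡m = ≤-antisym
      (≤-trans (∣∣-injection (∁ C) (⊤ {m}) (λ v e → pivot l e ≡ v)
          (λ {v} v∈ → [ (λ (e , eq) → e , ∈⊤ , eq)
                      , (λ v∈C → contradiction v∈C (x∈∁p⇒x∉p v∈)) ]′ (pivot⊎C v))
          (λ p q → trans (sym p) q))
        (≤-reflexive (∣⊤∣≡n m)))
      (≤-trans (≤-reflexive (sym (∣⊤∣≡n m)))
        (∣∣-injection (⊤ {m}) (∁ C) (λ e v → pivot l e ≡ v)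
          (λ {e} _ → pivot l e , x∉p⇒x∈∁p (pivot∉C e) , refl)
          (λ p q → pivot-injective l ∈⊤ ∈⊤ (trans p (sym q)))))

-- From cores to eliminations

module _ {H : Hypergraph n m} where

  -- A layering says nothing about vertices that lie in no edge. That these belong to the core comes
  -- from the activation run, which has no other way to reach them.
  activation-covers : ∀ {K K′ v} → Star (H ⊢_⇝_) K K′ → v ∈ proj₂ K′ →
                      v ∈ proj₂ K ⊎ ∃[ e ] v ∈ H e
  activation-covers ε v∈ = inj₁ v∈
  activation-covers (activate {C = C} e _ _ ◅ s) v∈ with activation-covers s v∈
  ... | inj₂ ∃e = inj₂ ∃e
  ... | inj₁ v∈C∪e with x∈p∪q⁻ C (H e) v∈C∪e
  ... | inj₁ v∈C = inj₁ v∈C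
  ... | inj₂ v∈e = inj₂ (e , v∈e)

  ∣C∪e∣≡1+∣C∣ : ∀ {C e} → OneMissing H C e → ∣ C ∪ H e ∣ ≡ suc ∣ C ∣
  ∣C∪e∣≡1+∣C∣ {C} {e} om with v , v∈e , v∉C , unique ← missing⁻ om =
    trans (x∈p⇒∣p∣≡1+∣p-x∣ (q⊆p∪q C (H e) v∈e)) (cong (suc ∘ ∣_∣) (⊆-antisym to from))
    where
    to : C ∪ H e - v ⊆ C
    to {w} w∈ with x∈p∪q⁻ C (H e) (p─q⊆p (C ∪ H e) _ w∈)
    ... | inj₁ w∈C = w∈C
    ... | inj₂ w∈e = decidable-stable (w ∈? C) λ w∉C →
      x∉p-x (C ∪ H e) v (subst (_∈ C ∪ H e - v) (unique w∈e w∉C) w∈)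
    from : C ⊆ C ∪ H e - v
    from w∈C = x∈p∧x≢y⇒x∈p-y (p⊆p∪q _ w∈C) (λ { refl → v∉C w∈C })

  -- |E| + |C| does not grow along a run: one vertex is gained per activation, and at least the
  -- activated edge is lost.
  activation-growth : ∀ {K K′} → Star (H ⊢_⇝_) K K′ →
                      ∣ proj₂ K′ ∣ ≤ ∣ proj₁ K ∣ + ∣ proj₂ K ∣
  activation-growth ε = m≤n+m _ _
  activation-growth {_} {_ , C′} (activate {E = E} {C = C} e e∈E om ◅ s) = begin
    ∣ C′ ∣                   ≤⟨ activation-growth s ⟩
    ∣ E₁ ∣ + ∣ C ∪ H e ∣     ≡⟨ cong (∣ E₁ ∣ +_) (∣C∪e∣≡1+∣C∣ om) ⟩
    ∣ E₁ ∣ + suc ∣ C ∣       ≡⟨ +-suc _ _ ⟩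
    suc (∣ E₁ ∣) + ∣ C ∣     ≤⟨ +-monoˡ-≤ ∣ C ∣ (∣survivors∣< H E C e e∈E) ⟩
    ∣ E ∣ + ∣ C ∣            ∎
    where
    open ≤-Reasoning
    E₁ = E ∩ ⟪ survives? H C e ⟫

  -- Every activation adds one vertex and removes at least one edge; in the
  -- extremal case it removes exactly one, which then owns its new vertex.
  activation⇒elimination : ∀ {K K′} → (Fin m → Fin n) → (s : Star (H ⊢_⇝_) K K′) →
    Empty (proj₁ K′) → ∣ proj₁ K ∣ + ∣ proj₂ K ∣ ≤ ∣ proj₂ K′ ∣ →
    ∃[ r ] ∃ λ (l : Elimination H (proj₁ K) r) → ∀ {e} → e ∈ proj₁ K → pivot l e ∉ proj₂ K
  activation⇒elimination pivot₀ ε ∄E _ = 0 , record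
    { time = λ _ → 0 ; pivot = pivot₀
    ; time< = λ e∈ → contradiction (_ , e∈) ∄E
    ; pivot∈ = λ e∈ → contradiction (_ , e∈) ∄E
    ; later = λ e∈ → contradiction (_ , e∈) ∄E } , λ e∈ → contradiction (_ , e∈) ∄E
  activation⇒elimination {E , C} {_ , C′} pivot₀ (activate e₁ e₁∈E om ◅ s) ∄E big =
    let r , l , l∉ = activation⇒elimination pivot₀ s ∄E big₁
    in suc r , elim r l l∉ , pivot∉ r l l∉
    where
    open ≤-Reasoning
    C₁ = C ∪ H e₁
    E₁ = E ∩ ⟪ survives? H C e₁ ⟫
    e₁∉E₁ : e₁ ∉ E₁
    e₁∉E₁ e∈ = survivors⊈ H E C e₁ e∈ (q⊆p∪q C (H e₁))
    big₁ : ∣ E₁ ∣ + ∣ C₁ ∣ ≤ ∣ C′ ∣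
    big₁ = begin
      ∣ E₁ ∣ + ∣ C₁ ∣      ≡⟨ cong (∣ E₁ ∣ +_) (∣C∪e∣≡1+∣C∣ om) ⟩
      ∣ E₁ ∣ + suc ∣ C ∣   ≡⟨ +-suc _ _ ⟩
      suc ∣ E₁ ∣ + ∣ C ∣   ≤⟨ +-monoˡ-≤ ∣ C ∣ (∣survivors∣< H E C e₁ e₁∈E) ⟩
      ∣ E ∣ + ∣ C ∣        ≤⟨ big ⟩
      ∣ C′ ∣               ∎
    ∣E∣≤ : ∣ E ∣ ≤ suc ∣ E₁ ∣
    ∣E∣≤ = +-cancelʳ-≤ ∣ C ∣ _ _ (begin
      ∣ E ∣ + ∣ C ∣        ≤⟨ big ⟩
      ∣ C′ ∣               ≤⟨ activation-growth s ⟩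
      ∣ E₁ ∣ + ∣ C₁ ∣      ≡⟨ cong (∣ E₁ ∣ +_) (∣C∪e∣≡1+∣C∣ om) ⟩
      ∣ E₁ ∣ + suc ∣ C ∣   ≡⟨ +-suc _ _ ⟩
      suc ∣ E₁ ∣ + ∣ C ∣   ∎)
    ∈E₁ : ∀ {e} → e ∈ E → e ≢ e₁ → e ∈ E₁
    ∈E₁ {e} e∈E e≢e₁ = decidable-stable (e ∈? E₁) λ e∉ →
      1+n≰n (≤-trans (∣q∣+2≤∣p∣ e₁∈E e∈E e≢e₁ (p∩q⊆p E _) e₁∉E₁ e∉) ∣E∣≤)
    new = missing⁻ om
    module _ r (l : Elimination H E₁ r) (l∉ : ∀ {e} → e ∈ E₁ → pivot l e ∉ C₁) where
      time′ : Fin m → ℕ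
      time′ e = if does (e Fin.≟ e₁) then 0 else suc (time l e)
      pivot′ : Fin m → Fin n
      pivot′ e = if does (e Fin.≟ e₁) then proj₁ new else pivot l e
      time′< : ∀ {e} → e ∈ E → time′ e < suc r
      time′< {e} e∈E with e Fin.≟ e₁
      ... | yes _   = z<s
      ... | no e≢e₁ = s≤s (time< l (∈E₁ e∈E e≢e₁))
      pivot′∈ : ∀ {e} → e ∈ E → pivot′ e ∈ H e
      pivot′∈ {e} e∈E with e Fin.≟ e₁
      ... | yes refl = proj₁ (proj₂ new)
      ... | no e≢e₁ = pivot∈ l (∈E₁ e∈E e≢e₁)
      later′ : ∀ {e e′} → e ∈ E → e′ ∈ E → pivot′ e ∈ H e′ → e ≡ e′ ⊎ time′ e < time′ e′
      later′ {e} {e′} e∈E e′∈E p∈ with e Fin.≟ e₁ | e′ Fin.≟ e₁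
      ... | yes refl | yes refl = inj₁ refl
      ... | yes refl | no _     = inj₂ z<s
      -- The reason for carrying "pivots lie outside the current set" through the induction: pivots
      -- of the remaining edges avoid `C ∪ H e₁`, so none of them occurs in the edge activated
      -- first.
      ... | no e≢e₁  | yes refl =
        contradiction (q⊆p∪q C (H e₁) p∈) (l∉ (∈E₁ e∈E e≢e₁))
      ... | no e≢e₁  | no e′≢e₁ with later l (∈E₁ e∈E e≢e₁) (∈E₁ e′∈E e′≢e₁) p∈
      ... | inj₁ e≡e′ = inj₁ e≡e′
      ... | inj₂ lt   = inj₂ (s≤s lt)
      elim : Elimination H E (suc r)
      elim = record { time = time′ ; pivot = pivot′ ; time< = time′<
                    ; pivot∈ = pivot′∈ ; later = later′ }
      pivot∉ : ∀ {e} → e ∈ E → pivot′ e ∉ C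
      pivot∉ {e} e∈E with e Fin.≟ e₁
      ... | yes refl = proj₁ (proj₂ (proj₂ new))
      ... | no e≢e₁ = l∉ (∈E₁ e∈E e≢e₁) ∘ p⊆p∪q _

-- If m exceeded n, the integer difference would be negative and could not be a cardinality.
+≡⊖⇒+≡ : ∀ {k} → ℤ.+ k ≡ n ℤ.⊖ m → k + m ≡ n
+≡⊖⇒+≡ {n} {m} eq with m ≤? n
... | yes m≤n = trans (cong (_+ m) (ℤ.+-injective (trans eq (ℤ.⊖-≥ m≤n)))) (m∸n+n≡m m≤n)
... | no m≰n with n ∸ m | m ∸ n | m<n⇒0<n∸m (≰⇒> m≰n) | trans eq (ℤ.⊖-< (≰⇒> m≰n))
... | _ | suc _ | _ | ()

module _ {H : Hypergraph n m} {C : Subset n} (core : IsCore[n-m] H C) where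

  private
    size : ∣ C ∣ + m ≡ n
    size = +≡⊖⇒+≡ (proj₂ core)

  core⇒elimination : ∃[ r ] Elimination H ⊤ r
  core⇒elimination with E′ , ∄E′ , s ← proj₁ core =
    let r , l , _ = activation⇒elimination (pivot₀ size) s ∄E′ (begin
          ∣ E ∣ + ∣ C ∣ ≤⟨ +-monoˡ-≤ ∣ C ∣ (∣p∣≤n E) ⟩
          m + ∣ C ∣     ≡⟨ trans (+-comm m _) size ⟩
          n             ≡⟨ ∣⊤∣≡n n ⟨
          ∣ ⊤ {n} ∣     ∎)
    in r , subst (λ X → Elimination H X r) (E≡⊤ s) l
    where
    open ≤-Reasoning
    E = proj₁ (activationStart H C)
    -- If n = 0, the size equation leaves no edges either, so a default vertex exists whenever one
    -- is asked for.
    pivot₀ : ∀ {n m k} → k + m ≡ n → Fin m → Fin n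
    pivot₀ {suc n} _ _ = zero
    pivot₀ {zero} {suc m} {k} eq e with () ← trans (sym (+-suc k m)) eq
    -- Had some edge been inside the core, fewer than m edges would be left to activate the m
    -- vertices outside it.
    E≡⊤ : ∀ {E′} → Star (H ⊢_⇝_) (E , C) (E′ , ⊤) → E ≡ ⊤
    E≡⊤ s = ∣p∣≡n⇒p≡⊤ (≤-antisym (∣p∣≤n E) (+-cancelʳ-≤ ∣ C ∣ _ _ (begin
      m + ∣ C ∣     ≡⟨ trans (+-comm m _) size ⟩
      n             ≡⟨ ∣⊤∣≡n n ⟨
      ∣ ⊤ {n} ∣     ≤⟨ activation-growth s ⟩
      ∣ E ∣ + ∣ C ∣ ∎)))

  -- The times are the given layers, so the bound is the given `r`. The elimination read off from an
  -- activation run has a bound unrelated to the radius and could not be used to compare radii.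
  layerable⇒elimination : Layerable H C r → Elimination H ⊤ r
  layerable⇒elimination {r} (layer , om) = record
    { time = toℕ ∘ layer ; pivot = pv
    ; time< = λ _ → Fin.toℕ<n _ ; pivot∈ = λ _ → pv∈ ; later = λ _ _ → order }
    where
    R : ℕ → Subset n
    R = reached H C layer
    pv : Fin m → Fin n
    pv e = proj₁ (missing⁻ (om e))
    pv∈ : ∀ {e} → pv e ∈ H e
    pv∈ {e} = proj₁ (proj₂ (missing⁻ (om e)))
    pv∉ : ∀ {e} → pv e ∉ R (toℕ (layer e))
    pv∉ {e} = proj₁ (proj₂ (proj₂ (missing⁻ (om e))))
    pv-unique : ∀ {e w} → w ∈ H e → w ∉ R (toℕ (layer e)) → w ≡ pv e
    pv-unique {e} = proj₂ (proj₂ (proj₂ (missing⁻ (om e))))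
    -- The missing vertex of the lowest edge containing v is v itself.
    surjective : ∀ {v} → v ∉ C → ∃[ e ] pv e ≡ v
    surjective {v} v∉C with _ , _ , s ← proj₁ core with activation-covers s (∈⊤ {x = v})
    ... | inj₁ v∈C = contradiction v∈C v∉C
    ... | inj₂ ∃e with e , v∈e , e-min ← argmin (toℕ ∘ layer) (λ e → v ∈? H e) ∃e =
      e , sym (pv-unique v∈e λ v∈R →
        [ v∉C , (λ (e′ , e′<e , v∈e′) → <⇒≱ e′<e (e-min v∈e′)) ]′
          (reached⁻ H C layer {toℕ (layer e)} v∈R))
    ∣∁C∣≡m : ∣ ∁ C ∣ ≡ m
    ∣∁C∣≡m = trans (∣∁p∣≡n∸∣p∣ C) (trans (cong (_∸ ∣ C ∣) (sym size)) (m+n∸m≡n ∣ C ∣ m))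
    -- If two edges shared their missing vertex, the other m - 1 edges would still cover the m
    -- vertices outside `C`.
    injective : ∀ {e e′} → pv e ≡ pv e′ → e ≡ e′
    injective {e} {e′} eq = decidable-stable (e Fin.≟ e′) λ e≢e′ →
      <-irrefl refl (begin-strict
        m           ≡⟨ ∣∁C∣≡m ⟨
        ∣ ∁ C ∣     ≤⟨ ∣∣-injection (∁ C) (⊤ - e′) (λ v e → pv e ≡ v)
                         (avoid e≢e′) (λ p q → trans (sym p) q) ⟩
        ∣ ⊤ - e′ ∣  <⟨ x∈p⇒∣p-x∣<∣p∣ (∈⊤ {x = e′}) ⟩
        ∣ ⊤ {m} ∣   ≡⟨ ∣⊤∣≡n m ⟩
        m           ∎)
      where
      open ≤-Reasoning
      avoid : e ≢ e′ → ∀ {v} → v ∈ ∁ C → ∃[ e″ ] e″ ∈ ⊤ - e′ × pv e″ ≡ v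
      avoid e≢e′ v∈ with e″ , p≡v ← surjective (x∈∁p⇒x∉p v∈) with e″ Fin.≟ e′
      ... | yes refl = e , x∈p∧x≢y⇒x∈p-y ∈⊤ e≢e′ , trans eq p≡v
      ... | no e″≢e′ = e″ , x∈p∧x≢y⇒x∈p-y ∈⊤ e″≢e′ , p≡v
    -- If e is not in a lower layer than e′, all that is reached before e′ is reached before e. Then
    -- `pv e` is missing from e′ as well, so it is the pivot of e′.
    order : ∀ {e e′} → pv e ∈ H e′ → e ≡ e′ ⊎ toℕ (layer e) < toℕ (layer e′)
    order {e} {e′} p∈ with toℕ (layer e) <? toℕ (layer e′)
    ... | yes lt = inj₂ lt
    ... | no ≮ = inj₁ (injective (pv-unique p∈ λ p∈R →
      [ pv∉ {e} ∘ core⊆reached H C layer (toℕ (layer e))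
      , (λ (_ , lt , p∈e″) →
          pv∉ {e} (edge⊆reached H C layer (<-≤-trans lt (≮⇒≥ ≮)) p∈e″))
      ]′ (reached⁻ H C layer {toℕ (layer e′)} p∈R)))

-- Correctness of the algorithm

terminates : (H : Hypergraph n m) → Terminates H
terminates H = Acc-⟶ (<-wellFounded _)

output-optimal : {H : Hypergraph n m} {res : Maybe (Subset n)} → Outputs H res →
  ∃[ C ] IsCore[n-m] H C → ∃[ C ] res ≡ just C × IsOptimalCore[n-m] H C
output-optimal (_ , s , failure E≢∅ ∄F) (_ , core) =
  contradiction E≢∅
    (not-stuck (restrict (run-⊆ s) l λ _ → time< l ∈⊤) ∄F)
  where l = proj₂ (core⇒elimination core)
output-optimal {H = H} (_ , s , success {Core = C} ∄E) (_ , core) =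
  C , refl , (elimination⇒core l C≡ , elimination⇒size l C≡) , rounds s ,
  -- `minimal` covers every core of size n - m and each of its layerings. For `C` itself it shows
  -- that the number of rounds is the radius; for the other cores it shows that this radius is
  -- optimal.
  (elimination⇒layerable l C≡ , λ _ → minimal (elimination⇒core l C≡ , elimination⇒size l C≡)) ,
  λ _ _ core′ radius → minimal core′ (proj₁ radius)
  where
  elim = run⇒elimination (pivot (proj₂ (core⇒elimination core))) s ∄E
  l = proj₁ elim
  C≡ = proj₂ elim
  minimal : ∀ {C′ r′} → IsCore[n-m] H C′ → Layerable H C′ r′ → rounds s ≤ r′
  minimal core′ layerable = rounds≤ (layerable⇒elimination core′ layerable) s

-- Cost-bounded executions

-- A Hoare triple for total correctness from one given memory, with a time budget `B`. Only an upper
-- bound on the steps is kept, so that budgets combine by plain arithmetic.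
record Run (H : Hypergraph n m) (c : Cmd (Fin n) (Fin m)) (σ : Memory n m)
           (B : ℕ) (Q : Memory n m → Set) : Set where
  constructor run
  field
    {steps}  : ℕ
    {final}  : Memory n m
    exec     : H ⊢ c , σ ⇓[ steps ] final
    bounded  : steps ≤ B
    holds    : Q final

indicator : Bool → ℕ
indicator true  = 1
indicator false = 0

module _ {H : Hypergraph n m} where

  weaken : ∀ {c σ A B} {P Q : Memory n m → Set} → A ≤ B → (∀ {σ} → P σ → Q σ) →
           Run H c σ A P → Run H c σ B Q
  weaken A≤B P⇒Q (run d t≤ p) = run d (≤-trans t≤ A≤B) (P⇒Q p)

  infixr 2 _⨾ʳ_
  _⨾ʳ_ : ∀ {c d σ A B} {P Q : Memory n m → Set} → Run H c σ A P →
         (∀ {σ} → P σ → Run H d σ B Q) → Run H (c ⨾ d) σ (1 + A + B) Q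
  run x t≤ p ⨾ʳ k with k p
  ... | run y s≤ q = run (⇓⨾ x y) (s≤s (+-mono-≤ t≤ s≤)) q

  assign : ∀ {x k σ} {Q : Memory n m → Set} → Q (σ [ x ↦ k ]) → Run H (x ≔ k) σ 1 Q
  assign q = run ⇓≔ ≤-refl q

  assign⨾ : ∀ {x k c σ B} {Q : Memory n m → Set} →
            Run H c (σ [ x ↦ k ]) B Q → Run H (x ≔ k ⨾ c) σ (2 + B) Q
  assign⨾ (run d t≤ q) = run (⇓⨾ ⇓≔ d) (s≤s (s≤s t≤)) q

  inc⨾ : ∀ {x c σ B} {Q : Memory n m → Set} →
         Run H c (σ [ x ↦ suc (σ x) ]) B Q → Run H (inc x ⨾ c) σ (2 + B) Q
  inc⨾ (run d t≤ q) = run (⇓⨾ ⇓inc d) (s≤s (s≤s t≤)) q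

  dec⨾ : ∀ {x c σ B} {Q : Memory n m → Set} →
         Run H c (σ [ x ↦ pred (σ x) ]) B Q → Run H (dec x ⨾ c) σ (2 + B) Q
  dec⨾ (run d t≤ q) = run (⇓⨾ ⇓dec d) (s≤s (s≤s t≤)) q

  -- The outcome of the test is passed in as `w`, which callers express through the subsets that the
  -- memory represents. The budget then does not mention the memory and can be summed over a loop.
  whenʳ : ∀ {t c σ B} {Q : Memory n m → Set} (w : Bool) → ⟦ t ⟧ H σ ≡ w →
          (w ≡ true → Run H c σ B Q) → (w ≡ false → Q σ) →
          Run H (when t then c) σ (1 + cost t + indicator w * B) Q
  whenʳ {t} {B = B} true eq yes-run _ with yes-run refl
  ... | run d t≤ q =
    run (⇓when-true eq d)
        (+-monoʳ-≤ (1 + cost t) (≤-trans t≤ (≤-reflexive (sym (+-identityʳ B))))) q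
  whenʳ {t} false eq _ no-run =
    run (⇓when-false eq) (≤-reflexive (sym (+-identityʳ (1 + cost t)))) (no-run refl)

  while-exit : ∀ {t c σ} {Q : Memory n m → Set} → ⟦ t ⟧ H σ ≡ false → Q σ →
               Run H (while t loop c) σ (1 + cost t) Q
  while-exit eq q = run (⇓while-false eq) ≤-refl q

  while-step : ∀ {t c σ A B} {P Q : Memory n m → Set} → ⟦ t ⟧ H σ ≡ true →
               Run H c σ A P → (∀ {σ} → P σ → Run H (while t loop c) σ B Q) →
               Run H (while t loop c) σ (1 + cost t + A + B) Q
  while-step {t} eq (run x t≤ p) k with k p
  ... | run y s≤ q = run (⇓while-true eq x y) (+-mono-≤ (+-monoʳ-≤ (1 + cost t) t≤) s≤) q

  -- The iterations x with w x may cost B more than the others.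
  unrollʳ : ∀ {k σ} (c : Fin k → Cmd (Fin n) (Fin m)) (w : Fin k → Bool) (A B : ℕ)
            (Inv : ℕ → Memory n m → Set) →
            (∀ x {σ} → Inv (toℕ x) σ →
              Run H (c x) σ (A + indicator (w x) * B) (Inv (suc (toℕ x)))) →
            Inv 0 σ →
            Run H (unroll c) σ (1 + k * (1 + A) + ∣ tabulate w ∣ * B) (Inv k)
  unrollʳ {zero} c w A B Inv step i = run ⇓skip ≤-refl i
  unrollʳ {suc k} c w A B Inv step i =
    weaken (bound (w zero)) id
      (step zero i ⨾ʳ unrollʳ (c ∘ suc) (w ∘ suc) A B (Inv ∘ suc) (step ∘ suc))
    where
    s = ∣ tabulate (w ∘ suc) ∣
    inside-bound : ∀ k A B s → 1 + (A + 1 * B) + (1 + k * (1 + A) + s * B) ≡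
                               1 + (1 + k) * (1 + A) + (1 + s) * B
    inside-bound = solve-∀
    outside-bound : ∀ k A B s → 1 + (A + 0 * B) + (1 + k * (1 + A) + s * B) ≡
                                1 + (1 + k) * (1 + A) + s * B
    outside-bound = solve-∀
    bound : ∀ b → 1 + (A + indicator b * B) + (1 + k * (1 + A) + s * B) ≤
                  1 + suc k * (1 + A) + ∣ b ∷ tabulate (w ∘ suc) ∣ * B
    bound true  = ≤-reflexive (inside-bound k A B s)
    bound false = ≤-reflexive (outside-bound k A B s)

  forVʳ : ∀ {σ c} (w : Fin n → Bool) (A B : ℕ) (Inv : ℕ → Memory n m → Set) →
          (∀ x {σ} → Inv (toℕ x) σ →
            Run H (c x) σ (A + indicator (w x) * B) (Inv (suc (toℕ x)))) →
          Inv 0 σ → Run H (forV c) σ (2 + n * (1 + A) + ∣ tabulate w ∣ * B) (Inv n)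
  forVʳ w A B Inv step i with unrollʳ _ w A B Inv step i
  ... | run d t≤ q = run (⇓forV d) (s≤s t≤) q

  forEʳ : ∀ {σ c} (w : Fin m → Bool) (A B : ℕ) (Inv : ℕ → Memory n m → Set) →
          (∀ x {σ} → Inv (toℕ x) σ →
            Run H (c x) σ (A + indicator (w x) * B) (Inv (suc (toℕ x)))) →
          Inv 0 σ → Run H (forE c) σ (2 + m * (1 + A) + ∣ tabulate w ∣ * B) (Inv m)
  forEʳ w A B Inv step i with unrollʳ _ w A B Inv step i
  ... | run d t≤ q = run (⇓forE d) (s≤s t≤) q

  private
    unweighted : ∀ k A s → 2 + k * (1 + A) + s * 0 ≡ 2 + k * (1 + A)
    unweighted = solve-∀

  forVᵘ : ∀ {σ c} (A : ℕ) (Inv : ℕ → Memory n m → Set) →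
          (∀ x {σ} → Inv (toℕ x) σ → Run H (c x) σ A (Inv (suc (toℕ x)))) →
          Inv 0 σ → Run H (forV c) σ (2 + n * (1 + A)) (Inv n)
  forVᵘ A Inv step i = weaken (≤-reflexive (unweighted n A ∣ tabulate {n = n} (λ _ → false) ∣)) id
    (forVʳ (λ _ → false) A 0 Inv (λ x → weaken (m≤m+n A 0) id ∘ step x) i)

  forEᵘ : ∀ {σ c} (A : ℕ) (Inv : ℕ → Memory n m → Set) →
          (∀ x {σ} → Inv (toℕ x) σ → Run H (c x) σ A (Inv (suc (toℕ x)))) →
          Inv 0 σ → Run H (forE c) σ (2 + m * (1 + A)) (Inv m)
  forEᵘ A Inv step i = weaken (≤-reflexive (unweighted m A ∣ tabulate {n = m} (λ _ → false) ∣)) id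
    (forEʳ (λ _ → false) A 0 Inv (λ x → weaken (m≤m+n A 0) id ∘ step x) i)

-- Subsets as arrays

toℕ<1+⇒≡⊎< : {x y : Fin a} → toℕ y < suc (toℕ x) → y ≡ x ⊎ toℕ y < toℕ x
toℕ<1+⇒≡⊎< y<1+x with m<1+n⇒m<n∨m≡n y<1+x
... | inj₁ y<x = inj₂ y<x
... | inj₂ y≡x = inj₁ (Fin.toℕ-injective y≡x)

∈⇒lookup : {p : Subset a} {x : Fin a} → x ∈ p → lookup p x ≡ true
∈⇒lookup = []=⇒lookup

lookup⇒∈ : {p : Subset a} {x : Fin a} → lookup p x ≡ true → x ∈ p
lookup⇒∈ = lookup⇒[]= _ _

∉⇒lookup : {p : Subset a} {x : Fin a} → x ∉ p → lookup p x ≡ false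
∉⇒lookup {p = p} {x} x∉p with lookup p x in eq
... | true  = contradiction (lookup⇒∈ eq) x∉p
... | false = refl

lookup⇒∉ : {p : Subset a} {x : Fin a} → lookup p x ≡ false → x ∉ p
lookup⇒∉ eq x∈p with () ← trans (sym eq) (∈⇒lookup x∈p)

does-∈? : (x : Fin a) (p : Subset a) → does (x ∈? p) ≡ lookup p x
does-∈? x p with x ∈? p
... | yes x∈p = sym (∈⇒lookup x∈p)
... | no x∉p  = sym (∉⇒lookup x∉p)

does-indicator : ∀ b → does (indicator b ≟ 1) ≡ b
does-indicator true  = refl
does-indicator false = refl

insert⁻ : {p : Subset a} {x y : Fin a} → y ∈ p [ x ]≔ inside → y ≡ x ⊎ y ∈ p
insert⁻ {p = p} {x} {y} y∈ with y Fin.≟ x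
... | yes y≡x = inj₁ y≡x
... | no y≢x  = inj₂ (lookup⇒∈ (trans (sym (lookup∘update′ y≢x p inside)) (∈⇒lookup y∈)))

insert-self : (p : Subset a) (x : Fin a) → x ∈ p [ x ]≔ inside
insert-self p x = lookup⇒∈ (lookup∘update x p inside)

insert⁺ : {p : Subset a} {x y : Fin a} → y ∈ p → y ∈ p [ x ]≔ inside
insert⁺ {p = p} {x} {y} y∈ with y Fin.≟ x
... | yes refl = insert-self p x
... | no y≢x   = lookup⇒∈ (trans (lookup∘update′ y≢x p inside) (∈⇒lookup y∈))

delete⁻ : {p : Subset a} {x y : Fin a} → y ∈ p [ x ]≔ outside → y ≢ x × y ∈ p
delete⁻ {p = p} {x} {y} y∈ with y Fin.≟ x
... | yes refl = contradiction y∈ (lookup⇒∉ (lookup∘update x p outside))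
... | no y≢x   =
  y≢x , lookup⇒∈ (trans (sym (lookup∘update′ y≢x p outside)) (∈⇒lookup y∈))

delete⁺ : {p : Subset a} {x y : Fin a} → y ≢ x → y ∈ p → y ∈ p [ x ]≔ outside
delete⁺ {p = p} y≢x y∈ = lookup⇒∈ (trans (lookup∘update′ y≢x p outside) (∈⇒lookup y∈))

∣∣-delete : (p : Subset a) {x : Fin a} → lookup p x ≡ true →
            ∣ p ∣ ≡ suc ∣ p [ x ]≔ outside ∣
∣∣-delete (true ∷ p)  {zero}  refl = refl
∣∣-delete (true ∷ p)  {suc x} eq   = cong suc (∣∣-delete p eq)
∣∣-delete (false ∷ p) {suc x} eq   = ∣∣-delete p eq

∣∩∣-delete : (p q : Subset a) {x : Fin a} → lookup p x ≡ true →
             ∣ p ∩ q ∣ ≡ indicator (lookup q x) + ∣ (p [ x ]≔ outside) ∩ q ∣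
∣∩∣-delete (true ∷ p)  (true ∷ q)  {zero}  refl = refl
∣∩∣-delete (true ∷ p)  (false ∷ q) {zero}  refl = refl
∣∩∣-delete (true ∷ p)  (true ∷ q)  {suc x} eq   =
  trans (cong suc (∣∩∣-delete p q eq)) (sym (+-suc (indicator (lookup q x)) _))
∣∩∣-delete (true ∷ p)  (false ∷ q) {suc x} eq   = ∣∩∣-delete p q eq
∣∩∣-delete (false ∷ p) (_ ∷ q)     {suc x} eq   = ∣∩∣-delete p q eq

-- Preserves the invariant of `deleteF`: striking an edge from both sets leaves their difference as
-- it was.
─-delete : (p q : Subset a) {x : Fin a} → lookup q x ≡ true →
           (p [ x ]≔ outside) ─ (q [ x ]≔ outside) ≡ p ─ q
─-delete (_ ∷ p) (true ∷ q)  {zero}  refl = refl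
─-delete (_ ∷ p) (true ∷ q)  {suc x} eq   = cong (false ∷_) (─-delete p q eq)
─-delete (s ∷ p) (false ∷ q) {suc x} eq   = cong (s ∷_) (─-delete p q eq)

∣∣-disjoint : (p q r : Subset a) → p ⊆ r → q ⊆ r → (∀ {x} → x ∈ p → x ∉ q) →
              ∣ p ∣ + ∣ q ∣ ≤ ∣ r ∣
∣∣-disjoint [] [] [] _ _ _ = z≤n
∣∣-disjoint (s ∷ p) (t ∷ q) (u ∷ r) p⊆r q⊆r disj
  with s | t | u | p⊆r {zero} | q⊆r {zero} | disj {zero}
     | ∣∣-disjoint p q r (drop-there ∘ p⊆r ∘ there) (drop-there ∘ q⊆r ∘ there)
                   (λ x∈p → disj (there x∈p) ∘ there)
... | true  | true  | _     | _  | _  | d | _  = contradiction here (d here)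
... | true  | false | false | f  | _  | _ | _  with () ← f here
... | false | true  | false | _  | f  | _ | _  with () ← f here
... | true  | false | true  | _  | _  | _ | ih = s≤s ih
... | false | true  | true  | _  | _  | _ | ih =
  ≤-trans (≤-reflexive (+-suc ∣ p ∣ ∣ q ∣)) (s≤s ih)
... | false | false | true  | _  | _  | _ | ih = m≤n⇒m≤1+n ih
... | false | false | false | _  | _  | _ | ih = ih

∣p─q∣+∣q∣≤∣p∣ : (p q : Subset a) → q ⊆ p → ∣ p ─ q ∣ + ∣ q ∣ ≤ ∣ p ∣
∣p─q∣+∣q∣≤∣p∣ p q q⊆p = ∣∣-disjoint (p ─ q) q p (p─q⊆p p q) q⊆p (x∈p─q⇒x∉q p q)

-- The conditional is what reading an updated array reduces to once the array numbers are literals,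
-- so this one fact serves vertex arrays and edge arrays.
write : (f : Fin a → ℕ) (p : Subset a) → (∀ y → f y ≡ indicator (lookup p y)) →
        ∀ x b y → (if does (x Fin.≟ y) then indicator b else f y) ≡
                  indicator (lookup (p [ x ]≔ b) y)
write f p f≡p x b y with x Fin.≟ y
... | yes refl = cong indicator (sym (lookup∘update x p b))
... | no x≢y   = trans (f≡p y) (cong indicator (sym (lookup∘update′ (x≢y ∘ sym) p b)))

-- Justifies the decrements in `deleteF` and, read backwards, the increments in `initialise`.
degree-delete : (H : Hypergraph n m) {E : Subset m} {e : Fin m} → lookup E e ≡ true → ∀ v →
  degree H E v ≡ indicator (lookup (H e) v) + degree H (E [ e ]≔ outside) v
degree-delete H {E} {e} e∈E v =
  trans (∣∩∣-delete E W e∈E)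
        (cong (λ b → indicator b + ∣ (E [ e ]≔ outside) ∩ W ∣)
              (trans (lookup∘tabulate _ e) (does-∈? v (H e))))
  where W = ⟪ (λ e → v ∈? H e) ⟫

-- The memory

update-same : (σ : Memory n m) {x : Cell (Fin n) (Fin m)} {k : ℕ} → (σ [ x ↦ k ]) x ≡ k
update-same σ {x} rewrite dec-true (x ≟ᶜ x) refl = refl

update-other : (σ : Memory n m) {x y : Cell (Fin n) (Fin m)} {k : ℕ} → x ≢ y →
               (σ [ x ↦ k ]) y ≡ σ y
update-other σ {x} {y} x≢y rewrite dec-false (x ≟ᶜ y) x≢y = refl

deg-injective : {v w : Fin n} → _≡_ {A = Cell (Fin n) (Fin m)} (deg v) (deg w) → v ≡ w
deg-injective refl = refl

record Rep (H : Hypergraph n m) (σ : Memory n m)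
           (E F : Subset m) (C : Subset n) : Set where
  field
    remaining≡ : σ remaining ≡ ∣ E ∣
    deg≡       : ∀ v → σ (deg v) ≡ degree H E v
    inE≡       : ∀ e → σ (inE e) ≡ indicator (lookup E e)
    inF≡       : ∀ e → σ (inF e) ≡ indicator (lookup F e)
    inCore≡    : ∀ v → σ (inCore v) ≡ indicator (lookup C v)

open Rep

record Adjusted (H : Hypergraph n m) (f : ℕ → ℕ) (e : Fin m) (σ σ′ : Memory n m) : Set where
  field
    adjusted  : ∀ v → σ′ (deg v) ≡ (if lookup (H e) v then f (σ (deg v)) else σ (deg v))
    unchanged : ∀ x → (∀ v → deg v ≢ x) → σ′ x ≡ σ x

open Adjusted

adjust-degrees : (H : Hypergraph n m) (f : ℕ → ℕ)
  (op : Cell (Fin n) (Fin m) → Cmd (Fin n) (Fin m)) →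
  (∀ {σ} x → H ⊢ op x , σ ⇓[ 1 ] (σ [ x ↦ f (σ x) ])) → ∀ e σ →
  Run H (forV (λ v → when e ∋ v then op (deg v))) σ (2 + n * 4) (Adjusted H f e σ)
adjust-degrees {n} {m} H f op op⇓ e σ =
  weaken ≤-refl (λ (done , _ , same) → record
           { adjusted = λ v → done v (Fin.toℕ<n v) ; unchanged = same })
         (forVᵘ 3 Inv step ((λ _ ()) , (λ _ _ → refl) , λ _ _ → refl))
  where
  new : Fin n → ℕ
  new v = if lookup (H e) v then f (σ (deg v)) else σ (deg v)
  Inv : ℕ → Memory n m → Set
  Inv i τ = (∀ v → toℕ v < i → τ (deg v) ≡ new v) ×
            (∀ v → i ≤ toℕ v → τ (deg v) ≡ σ (deg v)) ×
            (∀ x → (∀ v → deg v ≢ x) → τ x ≡ σ x)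
  step : ∀ v {τ} → Inv (toℕ v) τ →
         Run H (when e ∋ v then op (deg v)) τ 3 (Inv (suc (toℕ v)))
  step v {τ} (done , todo , same) with lookup (H e) v in v∈e
  ... | true = run (⇓when-true v∈e (op⇓ (deg v))) ≤-refl
    ( (λ w w≤v → [ (λ { refl → trans (update-same τ) (trans (cong f (todo v ≤-refl)) (new≡ v∈e)) })
                 , (λ w<v → trans (update-other τ λ eq →
                                      <-irrefl (cong toℕ (sym (deg-injective eq))) w<v)
                                  (done w w<v)) ]′ (toℕ<1+⇒≡⊎< w≤v))
    , (λ w v<w → trans (update-other τ (λ eq → <-irrefl (cong toℕ (deg-injective eq)) v<w))
                       (todo w (<⇒≤ v<w)))
    , (λ x x≢ → trans (update-other τ (x≢ v)) (same x x≢)) )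
    where
    new≡ : lookup (H e) v ≡ true → f (σ (deg v)) ≡ new v
    new≡ eq rewrite eq = refl
  ... | false = run (⇓when-false v∈e) (s≤s (s≤s z≤n))
    ( (λ w w≤v → [ (λ { refl → trans (todo v ≤-refl) (new≡ v∈e) }) , done w ]′ (toℕ<1+⇒≡⊎< w≤v))
    , (λ w v<w → todo w (<⇒≤ v<w))
    , same )
    where
    new≡ : lookup (H e) v ≡ false → σ (deg v) ≡ new v
    new≡ eq rewrite eq = refl

-- The program

initial : (m i : ℕ) → Subset m
initial m i = ⟪ (λ (e : Fin m) → toℕ e <? i) ⟫

lookup-⊤ : (x : Fin a) → lookup ⊤ x ≡ true
lookup-⊤ x = ∈⇒lookup (∈⊤ {x = x})

lookup-⊥ : (x : Fin a) → lookup ⊥ x ≡ false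
lookup-⊥ x = ∉⇒lookup (∉⊥ {x = x})

initial-delete : (e : Fin m) → initial m (suc (toℕ e)) [ e ]≔ outside ≡ initial m (toℕ e)
initial-delete {m} e = ⊆-antisym
  (λ x∈ → let x≢e , x∈ = delete⁻ x∈ in
     [ (λ x≡e → contradiction x≡e x≢e) , ∈⟪⟫⁺ (λ e′ → toℕ e′ <? toℕ e) ]′
       (toℕ<1+⇒≡⊎< (∈⟪⟫⁻ (λ e′ → toℕ e′ <? suc (toℕ e)) x∈)))
  (λ x∈ → let x<e = ∈⟪⟫⁻ (λ e′ → toℕ e′ <? toℕ e) x∈ in
     delete⁺ (λ { refl → <-irrefl refl x<e })
             (∈⟪⟫⁺ (λ e′ → toℕ e′ <? suc (toℕ e)) (m≤n⇒m≤1+n x<e)))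

initial-all : initial m m ≡ ⊤
initial-all {m} = ⊆-antisym ⊆⊤ (λ {e} _ → ∈⟪⟫⁺ (λ e′ → toℕ e′ <? m) (Fin.toℕ<n e))

degree≡0 : (H : Hypergraph n m) {E : Subset m} {v : Fin n} →
           (∀ {e} → e ∈ E → v ∉ H e) → degree H E v ≡ 0
degree≡0 {m = m} H {E} {v} none =
  trans (cong ∣_∣ (Empty-unique empty)) (∣⊥∣≡0 m)
  where
  empty : Empty (E ∩ ⟪ (λ e → v ∈? H e) ⟫)
  empty (e , e∈) with e∈E , v∈e ← incident⁻ H {v = v} e∈ = none e∈E v∈e

module _ (H : Hypergraph n m) where

  -- The initial memory is arbitrary: every cell that the rest of the program reads is written here
  -- first.
  initialise-run : ∀ σ → Run H initialise σ (9 + n * 4 + m * (9 + n * 4))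
                          (λ σ′ → Rep H σ′ ⊤ ⊥ ⊤ × σ′ stuck ≡ 0)
  initialise-run σ = weaken (≤-reflexive (bound n m)) finish
    (assign⨾ (assign⨾ (forVᵘ 3 Inv₁ step₁ ((λ _ ()) , refl , refl) ⨾ʳ λ i →
      forEᵘ (8 + n * 4) Inv₂ step₂ (start₂ i))))
    where
    bound : ∀ n m → 2 + (2 + (1 + (2 + n * 4) + (2 + m * (9 + n * 4)))) ≡
                    9 + n * 4 + m * (9 + n * 4)
    bound = solve-∀
    Inv₁ : ℕ → Memory n m → Set
    Inv₁ i τ = (∀ v → toℕ v < i → τ (inCore v) ≡ 1 × τ (deg v) ≡ 0) ×
               τ stuck ≡ 0 × τ remaining ≡ 0
    step₁ : ∀ v {τ} → Inv₁ (toℕ v) τ →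
            Run H (inCore v ≔ 1 ⨾ deg v ≔ 0) τ 3 (Inv₁ (suc (toℕ v)))
    step₁ v {τ} (done , s , r) = assign⨾ (assign (done′ , s , r))
      where
      τ′ = (τ [ inCore v ↦ 1 ]) [ deg v ↦ 0 ]
      done′ : ∀ w → toℕ w < suc (toℕ v) → τ′ (inCore w) ≡ 1 × τ′ (deg w) ≡ 0
      done′ w w≤v with v Fin.≟ w
      ... | yes refl = refl , refl
      ... | no v≢w = [ (λ { refl → contradiction refl v≢w }) , done w ]′ (toℕ<1+⇒≡⊎< w≤v)
    record Inv₂ (i : ℕ) (τ : Memory n m) : Set where
      field
        unstuck  : τ stuck ≡ 0
        count    : τ remaining ≡ i
        cores    : ∀ v → τ (inCore v) ≡ 1
        edges    : ∀ e → toℕ e < i → τ (inE e) ≡ 1 × τ (inF e) ≡ 0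
        degrees  : ∀ v → τ (deg v) ≡ degree H (initial m i) v
    open Inv₂
    start₂ : ∀ {τ} → Inv₁ n τ → Inv₂ 0 τ
    start₂ (done , s , r) = record
      { unstuck = s ; count = r
      ; cores = λ v → proj₁ (done v (Fin.toℕ<n v))
      ; edges = λ _ ()
      ; degrees = λ v → trans (proj₂ (done v (Fin.toℕ<n v)))
          (sym (degree≡0 H {v = v} λ e∈ →
            contradiction (∈⟪⟫⁻ (λ (e : Fin m) → toℕ e <? 0) e∈) n≮0)) }
    step₂ : ∀ e {τ} → Inv₂ (toℕ e) τ →
            Run H (inE e ≔ 1 ⨾ inF e ≔ 0 ⨾ inc remaining ⨾
                   forV (λ v → when e ∋ v then inc (deg v))) τ (8 + n * 4) (Inv₂ (suc (toℕ e)))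
    step₂ e {τ} I = assign⨾ (assign⨾ (inc⨾ (weaken ≤-refl next
      (adjust-degrees H suc inc (λ x → ⇓inc) e τ′))))
      where
      τ₁ = (τ [ inE e ↦ 1 ]) [ inF e ↦ 0 ]
      τ′ = τ₁ [ remaining ↦ suc (τ₁ remaining) ]
      next : ∀ {τ″} → Adjusted H suc e τ′ τ″ → Inv₂ (suc (toℕ e)) τ″
      next {τ″} A = record
        { unstuck = trans (unchanged A stuck (λ _ ())) (unstuck I)
        ; count = trans (unchanged A remaining (λ _ ())) (cong suc (count I))
        ; cores = λ v → trans (unchanged A (inCore v) (λ _ ())) (cores I v)
        ; edges = λ e′ lt → trans (unchanged A (inE e′) (λ _ ())) (proj₁ (edges′ e′ lt))
                          , trans (unchanged A (inF e′) (λ _ ())) (proj₂ (edges′ e′ lt))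
        ; degrees = degrees′ }
        where
        edges′ : ∀ e′ → toℕ e′ < suc (toℕ e) → τ′ (inE e′) ≡ 1 × τ′ (inF e′) ≡ 0
        edges′ e′ lt with e Fin.≟ e′
        ... | yes refl = refl , refl
        ... | no e≢e′ = [ (λ { refl → contradiction refl e≢e′ }) , edges I e′ ]′ (toℕ<1+⇒≡⊎< lt)
        degrees′ : ∀ v → τ″ (deg v) ≡ degree H (initial m (suc (toℕ e))) v
        degrees′ v = begin
          τ″ (deg v) ≡⟨ adjusted A v ⟩
          (if lookup (H e) v then suc (τ (deg v)) else τ (deg v)) ≡⟨ if-suc (lookup (H e) v) ⟩
          indicator (lookup (H e) v) + τ (deg v) ≡⟨ cong (_ +_) (degrees I v) ⟩
          indicator (lookup (H e) v) + degree H (initial m (toℕ e)) v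
            ≡⟨ cong (λ E → indicator (lookup (H e) v) + degree H E v) (initial-delete e) ⟨
          indicator (lookup (H e) v) + degree H (initial m (suc (toℕ e)) [ e ]≔ outside) v
            ≡⟨ degree-delete H {initial m (suc (toℕ e))}
                 (∈⇒lookup (∈⟪⟫⁺ (λ e′ → toℕ e′ <? suc (toℕ e)) (n<1+n (toℕ e)))) v ⟨
          degree H (initial m (suc (toℕ e))) v ∎
          where
          open ≡-Reasoning
          if-suc : ∀ b {k} → (if b then suc k else k) ≡ indicator b + k
          if-suc true  = refl
          if-suc false = refl
    finish : ∀ {τ} → Inv₂ m τ → Rep H τ ⊤ ⊥ ⊤ × τ stuck ≡ 0
    finish I = record
      { remaining≡ = trans (count I) (sym (∣⊤∣≡n m))
      ; deg≡ = λ v → trans (degrees I v) (cong (λ E → degree H E v) initial-all)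
      ; inE≡ = λ e → trans (proj₁ (edges I e (Fin.toℕ<n e))) (cong indicator (sym (lookup-⊤ e)))
      ; inF≡ = λ e → trans (proj₂ (edges I e (Fin.toℕ<n e))) (cong indicator (sym (lookup-⊥ e)))
      ; inCore≡ = λ v → trans (cores I v) (cong indicator (sym (lookup-⊤ v))) } , unstuck I

  -- Halfway through, the memory represents sets `E′` and `F′` whose difference is still `E ─ F`; at
  -- the end `F′` is empty and `E′` is that difference. Only edges of `F` pay for a scan of the
  -- vertices.
  deleteF-run : ∀ {σ E F C} → Rep H σ E F C → F ⊆ E →
    Run H deleteF σ (2 + m * 3 + ∣ F ∣ * (8 + n * 4))
        (λ σ′ → Rep H σ′ (E ─ F) ⊥ C × σ′ stuck ≡ σ stuck)
  deleteF-run {σ} {E} {F} {C} R F⊆E =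
    weaken (≤-reflexive (cong (λ p → 2 + m * 3 + ∣ p ∣ * (8 + n * 4)) (tabulate∘lookup F))) finish
      (forEʳ (lookup F) 2 (8 + n * 4) Inv step record
        { E′ = E ; F′ = F ; rep = R ; diff≡ = refl
        ; done = λ _ () ; todoF = λ _ _ → refl ; todoE = λ _ _ → refl ; same = refl })
    where
    record Inv (i : ℕ) (τ : Memory n m) : Set where
      field
        E′ F′ : Subset m
        rep   : Rep H τ E′ F′ C
        diff≡ : E′ ─ F′ ≡ E ─ F
        done  : ∀ e → toℕ e < i → lookup F′ e ≡ false
        todoF : ∀ e → i ≤ toℕ e → lookup F′ e ≡ lookup F e
        todoE : ∀ e → i ≤ toℕ e → lookup E′ e ≡ lookup E e
        same  : τ stuck ≡ σ stuck
    open Inv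
    step : ∀ e {τ} → Inv (toℕ e) τ →
           Run H (when inF e ≐ 1 then
                    (inF e ≔ 0 ⨾ inE e ≔ 0 ⨾ dec remaining ⨾
                     forV (λ v → when e ∋ v then dec (deg v)))) τ
               (2 + indicator (lookup F e) * (8 + n * 4)) (Inv (suc (toℕ e)))
    step e {τ} I = whenʳ (lookup F e) test
      (λ e∈F → assign⨾ (assign⨾ (dec⨾ (weaken ≤-refl (next e∈F)
        (adjust-degrees H pred dec (λ x → ⇓dec) e τ′)))))
      (λ e∉F → record
        { E′ = E′ I ; F′ = F′ I ; rep = rep I ; diff≡ = diff≡ I ; same = same I
        ; done = λ e′ lt → [ (λ { refl → trans (todoF I e ≤-refl) e∉F }) , done I e′ ]′
                             (toℕ<1+⇒≡⊎< lt)
        ; todoF = λ e′ lt → todoF I e′ (<⇒≤ lt)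
        ; todoE = λ e′ lt → todoE I e′ (<⇒≤ lt) })
      where
      test : does (τ (inF e) ≟ 1) ≡ lookup F e
      test = trans (cong (λ k → does (k ≟ 1)) (inF≡ (rep I) e))
                   (trans (does-indicator _) (todoF I e ≤-refl))
      τ₁ = (τ [ inF e ↦ 0 ]) [ inE e ↦ 0 ]
      τ′ = τ₁ [ remaining ↦ pred (τ₁ remaining) ]
      next : lookup F e ≡ true → ∀ {τ″} → Adjusted H pred e τ′ τ″ → Inv (suc (toℕ e)) τ″
      next e∈F {τ″} A = record
        { E′ = E′ I [ e ]≔ outside ; F′ = F′ I [ e ]≔ outside
        ; rep = record
          { remaining≡ = trans (unchanged A remaining (λ _ ()))
              (trans (cong pred (remaining≡ (rep I))) (cong pred (∣∣-delete (E′ I) e∈E′)))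
          ; deg≡ = degrees
          ; inE≡ = λ e′ → trans (unchanged A (inE e′) (λ _ ()))
              (write (λ e → τ (inE e)) (E′ I) (inE≡ (rep I)) e false e′)
          ; inF≡ = λ e′ → trans (unchanged A (inF e′) (λ _ ()))
              (write (λ e → τ (inF e)) (F′ I) (inF≡ (rep I)) e false e′)
          ; inCore≡ = λ v → trans (unchanged A (inCore v) (λ _ ())) (inCore≡ (rep I) v) }
        ; diff≡ = trans (─-delete (E′ I) (F′ I) e∈F′) (diff≡ I)
        ; done = λ e′ lt → done′ e′ (toℕ<1+⇒≡⊎< lt)
        ; todoF = λ e′ lt → trans (lookup∘update′ (above lt) (F′ I) outside) (todoF I e′ (<⇒≤ lt))
        ; todoE = λ e′ lt → trans (lookup∘update′ (above lt) (E′ I) outside) (todoE I e′ (<⇒≤ lt))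
        ; same = trans (unchanged A stuck (λ _ ())) (same I) }
        where
        e∈F′ : lookup (F′ I) e ≡ true
        e∈F′ = trans (todoF I e ≤-refl) e∈F
        e∈E′ : lookup (E′ I) e ≡ true
        e∈E′ = trans (todoE I e ≤-refl) (∈⇒lookup (F⊆E (lookup⇒∈ e∈F)))
        above : ∀ {e′} → toℕ e < toℕ e′ → e′ ≢ e
        above lt refl = <-irrefl refl lt
        done′ : ∀ e′ → e′ ≡ e ⊎ toℕ e′ < toℕ e → lookup (F′ I [ e ]≔ outside) e′ ≡ false
        done′ e′ (inj₁ refl) = lookup∘update e (F′ I) outside
        done′ e′ (inj₂ lt) =
          trans (lookup∘update′ (λ { refl → <-irrefl refl lt }) (F′ I) outside) (done I e′ lt)
        degrees : ∀ v → τ″ (deg v) ≡ degree H (E′ I [ e ]≔ outside) v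
        degrees v rewrite adjusted A v | deg≡ (rep I) v | degree-delete H {E′ I} e∈E′ v
          with lookup (H e) v
        ... | true  = refl
        ... | false = refl
    finish : ∀ {τ} → Inv m τ → Rep H τ (E ─ F) ⊥ C × τ stuck ≡ σ stuck
    finish {τ} I = subst₂ (λ X Y → Rep H τ X Y C) E′≡ F′≡⊥ (rep I) , same I
      where
      F′≡⊥ : F′ I ≡ ⊥
      F′≡⊥ = Empty-unique λ (e , e∈) → lookup⇒∉ (done I e (Fin.toℕ<n e)) e∈
      E′≡ : E′ I ≡ E ─ F
      E′≡ = trans (trans (sym (p─⊥≡p (E′ I))) (cong (E′ I ─_) (sym F′≡⊥))) (diff≡ I)

module _ (H : Hypergraph n m) where

  -- During buildF the memory is determined by a ghost variable: the vertex
  -- selected so far for each edge.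
  record Selected (E : Subset m) (C : Subset n) (τ : Memory n m) : Set where
    field
      select : Fin m → Maybe (Fin n)
      F      : Subset m
      C′     : Subset n
      rep    : Rep H τ E F C′
      sound  : ∀ {e v} → select e ≡ just v → e ∈ E × v ∈ H e × degree H E v ≡ 1
      F⇒     : ∀ {e} → e ∈ F → ∃[ v ] select e ≡ just v
      ⇒F     : ∀ {e v} → select e ≡ just v → e ∈ F
      C′⇒    : ∀ {v} → v ∈ C′ → v ∈ C × (∀ e → select e ≢ just v)
      ⇒C′    : ∀ {v} → v ∈ C → (∀ e → select e ≢ just v) → v ∈ C′
      flag   : (τ stuck ≡ 0 × Nonempty F) ⊎ (τ stuck ≡ 1 × Empty F)

  open Selected

  -- An edge may contain several vertices of degree one. As `e` is not yet in `F`, no earlier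
  -- selection is overwritten, so an edge never takes a second vertex out of the core.
  select-edge : ∀ {E C τ v e} (S : Selected E C τ) → degree H E v ≡ 1 →
    e ∈ E → v ∈ H e → e ∉ F S →
    ∃ λ (S′ : Selected E C (((τ [ inF e ↦ 1 ]) [ inCore v ↦ 0 ]) [ stuck ↦ 0 ])) →
      F S′ ≡ F S [ e ]≔ inside
  select-edge {E} {C} {τ} {v} {e} S deg1 e∈E v∈e e∉F = record
    { select = select′ ; F = F S [ e ]≔ inside ; C′ = C′ S [ v ]≔ outside
    ; rep = record
      { remaining≡ = remaining≡ (rep S) ; deg≡ = deg≡ (rep S) ; inE≡ = inE≡ (rep S)
      ; inF≡ = write (λ e → τ (inF e)) (F S) (inF≡ (rep S)) e true
      ; inCore≡ = write (λ v → τ (inCore v)) (C′ S) (inCore≡ (rep S)) v false }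
    ; sound = λ {e′} → sound′ e′
    ; F⇒ = λ e′∈ → [ (λ { refl → v , select-e }) ,
                     (λ e′∈F → let w , eq = F⇒ S e′∈F in w , trans (select-other e′∈F) eq) ]′
                     (insert⁻ e′∈)
    ; ⇒F = λ {e′} → ⇒F′ e′
    ; C′⇒ = λ w∈ → let w≢v , w∈C′ = delete⁻ w∈ ; w∈C , free = C′⇒ S w∈C′ in w∈C , free′ w≢v free
    ; ⇒C′ = λ w∈C free → delete⁺ (λ { refl → free e select-e }) (⇒C′ S w∈C (old-free free))
    ; flag = inj₁ (refl , e , insert-self (F S) e) } , refl
    where
    select′ : Fin m → Maybe (Fin n)
    select′ e′ = if does (e′ Fin.≟ e) then just v else select S e′
    select-e : select′ e ≡ just v
    select-e rewrite dec-true (e Fin.≟ e) refl = refl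
    select-other : ∀ {e′} → e′ ∈ F S → select′ e′ ≡ select S e′
    select-other {e′} e′∈F rewrite dec-false (e′ Fin.≟ e) (λ { refl → e∉F e′∈F }) = refl
    sound′ : ∀ e′ {w} → select′ e′ ≡ just w → e′ ∈ E × w ∈ H e′ × degree H E w ≡ 1
    sound′ e′ eq with e′ Fin.≟ e
    sound′ e′ refl | yes refl = e∈E , v∈e , deg1
    sound′ e′ eq   | no _     = sound S eq
    ⇒F′ : ∀ e′ {w} → select′ e′ ≡ just w → e′ ∈ F S [ e ]≔ inside
    ⇒F′ e′ eq with e′ Fin.≟ e
    ... | yes refl = insert-self (F S) e
    ... | no _     = insert⁺ (⇒F S eq)
    free′ : ∀ {w} → w ≢ v → (∀ e → select S e ≢ just w) → ∀ e → select′ e ≢ just w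
    free′ w≢v free e′ eq with e′ Fin.≟ e
    ... | yes refl = w≢v (sym (just-injective eq))
    ... | no _     = free e′ eq
    old-free : ∀ {w} → (∀ e → select′ e ≢ just w) → ∀ e → select S e ≢ just w
    old-free free e′ eq = free e′ (trans (select-other (⇒F S eq)) eq)

  selection⇒round : ∀ {E C τ} (S : Selected E C τ) → F S ≡ peelable H E →
    Nonempty (F S) → H ⊢ (E , C) ⟶ (E ─ peelable H E , C′ S)
  selection⇒round {E} {C} S F≡ (e₀ , e₀∈F) =
    subst (λ X → H ⊢ (E , C) ⟶ (E ─ peelable H E , X)) (⊆-antisym to from)
          (round pick (e₀ , subst (e₀ ∈_) F≡ e₀∈F) picks)
    where
    pick : Fin m → Fin n
    -- Off the selected edges the value is arbitrary; the vertex selected for `e₀` serves as the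
    -- default.
    pick e = fromMaybe (proj₁ (F⇒ S e₀∈F)) (select S e)
    pick≡ : ∀ {e v} → select S e ≡ just v → pick e ≡ v
    pick≡ eq rewrite eq = refl
    selected : ∀ {e} → e ∈ peelable H E → select S e ≡ just (pick e)
    selected {e} e∈ with v , eq ← F⇒ S (subst (e ∈_) (sym F≡) e∈) =
      trans eq (cong just (sym (pick≡ eq)))
    picks : ∀ {e} → e ∈ peelable H E → pick e ∈ H e × degree H E (pick e) ≡ 1
    picks e∈ = proj₂ (sound S (selected e∈))
    to : C ─ image pick (peelable H E) ⊆ C′ S
    to {v} v∈ = ⇒C′ S (p─q⊆p C _ v∈) λ e eq → x∈p─q⇒x∉q C _ v∈
      (subst (_∈ image pick (peelable H E)) (pick≡ eq)
             (image⁺ pick (subst (e ∈_) F≡ (⇒F S eq))))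
    from : C′ S ⊆ C ─ image pick (peelable H E)
    from v∈ with v∈C , free ← C′⇒ S v∈ = x∈p∧x∉q⇒x∈p─q v∈C λ v∈i →
      let e , e∈ , p≡v = image⁻ pick v∈i in free e (trans (selected e∈) (cong just p≡v))

  degree-one : Subset m → Subset n
  degree-one E = ⟪ (λ v → degree H E v ≟ 1) ⟫

  record Built (E : Subset m) (C : Subset n) (τ : Memory n m) : Set where
    field
      C′  : Subset n
      rep : Rep H τ E (peelable H E) C′
      outcome : (τ stuck ≡ 0 × H ⊢ (E , C) ⟶ (E ─ peelable H E , C′)) ⊎
                (τ stuck ≡ 1 × Empty (peelable H E))

  -- Deletion is postponed to `deleteF`, so degrees refer to the same `E` throughout and the order
  -- of the vertices does not affect `F`. The scan over edges is entered only at vertices of degree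
  -- one, hence the weight.
  buildF-run : ∀ {σ E C} → Rep H σ E ⊥ C →
    Run H buildF σ (4 + n * 3 + ∣ degree-one E ∣ * (2 + m * 12)) (Built E C)
  buildF-run {σ} {E} {C} R = weaken ≤-refl finish
    (assign⨾ (forVʳ (λ v → does (degree H E v ≟ 1)) 2 (2 + m * 12) Inv step
      (start , λ _ _ ())))
    where
    start : Selected E C (σ [ stuck ↦ 1 ])
    start = record
      { select = λ _ → nothing ; F = ⊥ ; C′ = C
      ; rep = record { remaining≡ = remaining≡ R ; deg≡ = deg≡ R ; inE≡ = inE≡ R
                     ; inF≡ = inF≡ R ; inCore≡ = inCore≡ R }
      ; sound = λ () ; F⇒ = λ e∈ → contradiction e∈ ∉⊥ ; ⇒F = λ ()
      ; C′⇒ = λ v∈ → v∈ , λ _ () ; ⇒C′ = λ v∈ _ → v∈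
      ; flag = inj₂ (refl , λ (_ , e∈) → ∉⊥ e∈) }
    Complete : (τ : Memory n m) → Selected E C τ → Fin n → Fin m → Set
    Complete τ S v e = degree H E v ≡ 1 → e ∈ E → v ∈ H e → e ∈ F S
    Inv : ℕ → Memory n m → Set
    Inv i τ = ∃ λ (S : Selected E C τ) → ∀ v e → toℕ v < i → Complete τ S v e
    step : ∀ v {τ} → Inv (toℕ v) τ →
           Run H (when deg v ≐ 1 then
             forE (λ e → when inE e ≐ 1 ∧ᵗ e ∋ v ∧ᵗ inF e ≐ 0 then
               (inF e ≔ 1 ⨾ inCore v ≔ 0 ⨾ stuck ≔ 0))) τ
             (2 + indicator (does (degree H E v ≟ 1)) * (2 + m * 12)) (Inv (suc (toℕ v)))
    step v {τ} (S , complete) = whenʳ (does (degree H E v ≟ 1))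
      (cong (λ k → does (k ≟ 1)) (deg≡ (rep S) v))
      (λ eq → weaken ≤-refl
        (λ (S , old , new) → S , λ w e w≤v →
          [ (λ { refl _ → new e (Fin.toℕ<n e) }) , old w e ]′ (toℕ<1+⇒≡⊎< w≤v))
        (forEᵘ 11 Inv₂ (step₂ (does⇒ (degree H E v ≟ 1) eq)) (S , complete , λ _ ())))
      (λ eq → S , λ w e w≤v →
        [ (λ { refl deg1 → contradiction (trans (sym (dec-true (degree H E v ≟ 1) deg1)) eq) λ () })
        , complete w e ]′ (toℕ<1+⇒≡⊎< w≤v))
      where
      does⇒ : ∀ {A : Set} (A? : Dec A) → does A? ≡ true → A
      does⇒ (yes p) refl = p
      Inv₂ : ℕ → Memory n m → Set
      Inv₂ j τ = ∃ λ (S : Selected E C τ) →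
        (∀ w e → toℕ w < toℕ v → Complete τ S w e) ×
        (∀ e → toℕ e < j → e ∈ E → v ∈ H e → e ∈ F S)
      step₂ : degree H E v ≡ 1 → ∀ e {τ} → Inv₂ (toℕ e) τ →
              Run H (when inE e ≐ 1 ∧ᵗ e ∋ v ∧ᵗ inF e ≐ 0 then
                       (inF e ≔ 1 ⨾ inCore v ≔ 0 ⨾ stuck ≔ 0)) τ 11 (Inv₂ (suc (toℕ e)))
      step₂ deg1 e {τ} (S , old , new) = weaken (cost≤ chosen?) id
        (whenʳ chosen? test
          (λ eq → let e∈E , v∈e , e∉F = chosen _ _ _ eq
                      S′ , F≡ = select-edge S deg1 (lookup⇒∈ e∈E) (lookup⇒∈ v∈e) (lookup⇒∉ e∉F)
                      grow : ∀ {e′} → e′ ∈ F S → e′ ∈ F S′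
                      grow e′∈ = subst (_ ∈_) (sym F≡) (insert⁺ e′∈)
                  in assign⨾ (assign⨾ (assign
                       ( S′ , (λ w e′ w<v d1 e′∈E w∈e′ → grow (old w e′ w<v d1 e′∈E w∈e′))
                       , λ e′ e′≤e e′∈E v∈e′ →
                           [ (λ { refl → subst (e ∈_) (sym F≡) (insert-self (F S) e) })
                           , (λ e′<e → grow (new e′ e′<e e′∈E v∈e′)) ]′ (toℕ<1+⇒≡⊎< e′≤e)))))
          (λ eq → S , old , λ e′ e′≤e e′∈E v∈e′ →
            [ (λ { refl → lookup⇒∈ (skipped (∈⇒lookup e′∈E) (∈⇒lookup v∈e′) eq) })
            , (λ e′<e → new e′ e′<e e′∈E v∈e′) ]′ (toℕ<1+⇒≡⊎< e′≤e)))
        where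
        chosen? : Bool
        chosen? = lookup E e ∧ lookup (H e) v ∧ not (lookup (F S) e)
        -- 6 is the conditional with its compound test; 5 is three assignments joined by two
        -- compositions.
        cost≤ : ∀ b → 6 + indicator b * 5 ≤ 11
        cost≤ true  = ≤-refl
        cost≤ false = m≤m+n 6 5
        does-indicator₀ : ∀ b → does (indicator b ≟ 0) ≡ not b
        does-indicator₀ true  = refl
        does-indicator₀ false = refl
        test : does (τ (inE e) ≟ 1) ∧ lookup (H e) v ∧ does (τ (inF e) ≟ 0) ≡ chosen?
        test rewrite inE≡ (rep S) e | inF≡ (rep S) e
                   | does-indicator (lookup E e) | does-indicator₀ (lookup (F S) e) = refl
        chosen : ∀ x y z → x ∧ y ∧ not z ≡ true → x ≡ true × y ≡ true × z ≡ false
        chosen true true false _ = refl , refl , refl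
        skipped : ∀ {x y z} → x ≡ true → y ≡ true → x ∧ y ∧ not z ≡ false → z ≡ true
        skipped {z = true} refl refl _ = refl
    finish : ∀ {τ} → Inv n τ → Built E C τ
    finish {τ} (S , complete) = record
      { C′ = C′ S ; rep = subst (λ X → Rep H τ E X (C′ S)) F≡ (rep S)
      ; outcome = [ (λ (z , F≢∅) → inj₁ (z , selection⇒round S F≡ F≢∅))
                  , (λ (o , ∄F) → inj₂ (o , subst Empty F≡ ∄F)) ]′ (flag S) }
      where
      F≡ : F S ≡ peelable H E
      F≡ = ⊆-antisym
        (λ e∈F → let _ , eq = F⇒ S e∈F ; e∈E , v∈e , d1 = sound S eq in peelable⁺ H e∈E v∈e d1)
        (λ {e} e∈P → let e∈E , v , v∈e , d1 = peelable⁻ H e∈P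
                     in complete v e (Fin.toℕ<n v) d1 e∈E v∈e)

  -- Amortised cost of the main loop

  degree≢0⇒∃ : ∀ {E v} → degree H E v ≢ 0 → ∃[ e ] e ∈ E × v ∈ H e
  degree≢0⇒∃ {E} {v} d≢0 with Fin.any? (λ e → (e ∈? E) ×-dec (v ∈? H e))
  ... | yes ∃e = ∃e
  ... | no ∄e = contradiction (degree≡0 H {v = v} λ e∈E v∈e → ∄e (_ , e∈E , v∈e)) d≢0

  ∃⇒degree≢0 : ∀ {E v e} → e ∈ E → v ∈ H e → degree H E v ≢ 0
  ∃⇒degree≢0 {v = v} e∈E v∈e d≡0 =
    <-irrefl (sym d≡0) (x∈p⇒0<∣p∣ (incident⁺ H {v = v} e∈E v∈e))

  live : Subset m → Subset n
  live E = ⟪ (λ v → ¬? (degree H E v ≟ 0)) ⟫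

  private
    live? : ∀ E → Decidable (λ v → degree H E v ≢ 0)
    live? E v = ¬? (degree H E v ≟ 0)

  degree-one⊆live : ∀ {E} → degree-one E ⊆ live E
  degree-one⊆live {E} {v} v∈ = ∈⟪⟫⁺ (live? E) λ d≡0 →
    contradiction (trans (sym d≡0) (∈⟪⟫⁻ (λ v → degree H E v ≟ 1) v∈)) λ ()

  -- The only edge containing a vertex of degree one is peeled in this round, which leaves the
  -- vertex with degree 0. So a vertex pays for at most one scan of the edges in the whole run.
  live-peel : ∀ E → ∣ live (E ─ peelable H E) ∣ + ∣ degree-one E ∣ ≤ ∣ live E ∣
  live-peel E = ∣∣-disjoint (live (E ─ peelable H E)) (degree-one E) (live E)
    (λ v∈ → let e , e∈ , v∈e = live⇒∃ v∈
            in ∈⟪⟫⁺ (live? E) (∃⇒degree≢0 (p─q⊆p E _ e∈) v∈e))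
    (degree-one⊆live {E})
    (λ v∈ v∈₁ → let e , e∈ , v∈e = live⇒∃ v∈
                in x∈p─q⇒x∉q E _ e∈
                     (peelable⁺ H (p─q⊆p E _ e∈) v∈e (∈⟪⟫⁻ (λ v → degree H E v ≟ 1) v∈₁)))
    where
    live⇒∃ : ∀ {v} → v ∈ live (E ─ peelable H E) → ∃[ e ] e ∈ E ─ peelable H E × v ∈ H e
    live⇒∃ v∈ = degree≢0⇒∃ (∈⟪⟫⁻ (live? (E ─ peelable H E)) v∈)

  -- A potential. A live vertex holds its edge scan, 2 + 12m, and a surcharge 12 + 3m; an edge holds
  -- its deletion, 8 + 4n, and a surcharge 3n. The surcharges of one vertex and one edge add up to
  -- the fixed cost 12 + 3n + 3m of a round. The last summand is that fixed cost once more, for a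
  -- round that peels nothing, and 5 for the final loop test.
  loop-bound : Subset m → ℕ
  loop-bound E = ∣ live E ∣ * (14 + 15 * m) + ∣ E ∣ * (8 + 7 * n) + (17 + 3 * n + 3 * m)

  round-bound : ℕ → ℕ → ℕ
  round-bound δ φ = 6 + ((4 + n * 3 + δ * (2 + m * 12)) + (2 + m * 3 + φ * (8 + n * 4)))

  main-loop : Cmd (Fin n) (Fin m)
  main-loop = while (¬ᵗ (remaining ≐ 0)) ∧ᵗ stuck ≐ 0 loop (buildF ⨾ deleteF)

  result-just : ∀ {σ E F C} → Rep H σ E F C → σ stuck ≡ 0 → result σ ≡ just C
  result-just {σ} {C = C} R z rewrite z = cong just (begin
    ⟪ (λ v → σ (inCore v) ≟ 1) ⟫ ≡⟨ tabulate-cong (λ v →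
      trans (cong (λ k → does (k ≟ 1)) (inCore≡ R v)) (does-indicator (lookup C v))) ⟩
    tabulate (lookup C)           ≡⟨ tabulate∘lookup C ⟩
    C                             ∎)
    where open ≡-Reasoning

  result-nothing : ∀ {σ : Memory n m} → σ stuck ≡ 1 → result σ ≡ nothing
  result-nothing o rewrite o = refl

  -- Besides O(n + m), a round costs O(m) per vertex of degree one and O(n) per
  -- peeled edge.  Unless nothing is peeled, the O(n + m) is absorbed by these
  -- costs, and those vertices and edges never contribute again.
  productive-bound : ∀ {δ φ l l′ k k′} Z → 1 ≤ δ → 1 ≤ φ → l′ + δ ≤ l → k′ + φ ≤ k →
    round-bound δ φ + (l′ * (14 + 15 * m) + k′ * (8 + 7 * n) + Z) ≤
    l * (14 + 15 * m) + k * (8 + 7 * n) + Z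
  productive-bound {δ} {φ} {l} {l′} {k} {k′} Z 1≤δ 1≤φ l≤ k≤ = begin
    round-bound δ φ + (l′ * X + k′ * Y + Z) ≡⟨ split n m δ φ _ ⟩
    1 * (12 + 3 * m) + 1 * (3 * n) + (δ * (2 + 12 * m) + φ * (8 + 4 * n) + (l′ * X + k′ * Y + Z))
      ≤⟨ +-monoˡ-≤ (δ * (2 + 12 * m) + φ * (8 + 4 * n) + (l′ * X + k′ * Y + Z))
           (+-mono-≤ (*-monoˡ-≤ (12 + 3 * m) 1≤δ) (*-monoˡ-≤ (3 * n) 1≤φ)) ⟩
    δ * (12 + 3 * m) + φ * (3 * n) + (δ * (2 + 12 * m) + φ * (8 + 4 * n) + (l′ * X + k′ * Y + Z))
      ≡⟨ collect n m δ φ l′ k′ Z ⟩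
    (l′ + δ) * X + (k′ + φ) * Y + Z
      ≤⟨ +-monoˡ-≤ Z (+-mono-≤ (*-monoˡ-≤ X l≤) (*-monoˡ-≤ Y k≤)) ⟩
    l * X + k * Y + Z ∎
    where
    open ≤-Reasoning
    X = 14 + 15 * m
    Y = 8 + 7 * n
    split : ∀ n m δ φ R →
      6 + ((4 + n * 3 + δ * (2 + m * 12)) + (2 + m * 3 + φ * (8 + n * 4))) + R ≡
      1 * (12 + 3 * m) + 1 * (3 * n) + (δ * (2 + 12 * m) + φ * (8 + 4 * n) + R)
    split = solve-∀
    collect : ∀ n m δ φ l k Z →
      δ * (12 + 3 * m) + φ * (3 * n) +
        (δ * (2 + 12 * m) + φ * (8 + 4 * n) + (l * (14 + 15 * m) + k * (8 + 7 * n) + Z)) ≡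
      (l + δ) * (14 + 15 * m) + (k + φ) * (8 + 7 * n) + Z
    collect = solve-∀

  -- A round that peels nothing leaves `stuck` set and ends the loop, so its fixed cost occurs at
  -- most once and can be kept in the constant summand.
  stuck-bound : ∀ {δ φ l k} → δ ≤ l → φ ≤ k →
    round-bound δ φ + 5 ≤ l * (14 + 15 * m) + k * (8 + 7 * n) + (17 + 3 * n + 3 * m)
  stuck-bound {δ} {φ} {l} {k} δ≤l φ≤k = begin
    round-bound δ φ + 5 ≡⟨ split n m δ φ ⟩
    δ * (2 + 12 * m) + φ * (8 + 4 * n) + Z
      ≤⟨ +-monoˡ-≤ Z (+-mono-≤ (*-mono-≤ δ≤l (+-mono-≤ (m≤m+n 2 12) (*-monoˡ-≤ m (m≤m+n 12 3))))
                               (*-mono-≤ φ≤k (+-monoʳ-≤ 8 (*-monoˡ-≤ n (m≤m+n 4 3))))) ⟩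
    l * (14 + 15 * m) + k * (8 + 7 * n) + Z ∎
    where
    open ≤-Reasoning
    Z = 17 + 3 * n + 3 * m
    split : ∀ n m δ φ →
      6 + ((4 + n * 3 + δ * (2 + m * 12)) + (2 + m * 3 + φ * (8 + n * 4))) + 5 ≡
      δ * (2 + 12 * m) + φ * (8 + 4 * n) + (17 + 3 * n + 3 * m)
    split = solve-∀

  round-run : ∀ {σ E C} → Rep H σ E ⊥ C →
    Run H (buildF ⨾ deleteF) σ
        (1 + (4 + n * 3 + ∣ degree-one E ∣ * (2 + m * 12)) +
             (2 + m * 3 + ∣ peelable H E ∣ * (8 + n * 4)))
        (λ τ → ∃[ C′ ] Rep H τ (E ─ peelable H E) ⊥ C′ ×
               ((τ stuck ≡ 0 × H ⊢ (E , C) ⟶ (E ─ peelable H E , C′)) ⊎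
                (τ stuck ≡ 1 × Empty (peelable H E))))
  round-run R = buildF-run R ⨾ʳ λ B → weaken ≤-refl
    (λ (R′ , same) → Built.C′ B , R′ ,
      [ (λ (z , r) → inj₁ (trans same z , r)) , (λ (o , ∄F) → inj₂ (trans same o , ∄F)) ]′
        (Built.outcome B))
    (deleteF-run H (Built.rep B) (peelable⊆ H))

  continue : ∀ {σ E F C} → Rep H σ E F C → σ stuck ≡ 0 → Nonempty E →
             not (does (σ remaining ≟ 0)) ∧ does (σ stuck ≟ 0) ≡ true
  continue {E = E} R z (e , e∈E)
    rewrite remaining≡ R | z | dec-false (∣ E ∣ ≟ 0) (>⇒≢ (x∈p⇒0<∣p∣ e∈E)) = refl

  -- The recursion is on termination of the abstract algorithm, as a productive iteration simulates
  -- one of its rounds. `reach` collects these rounds, so the final memory holds an output of the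
  -- abstract algorithm, to which the correctness result applies.
  loop-run : ∀ {σ E C} → Acc (flip (H ⊢_⟶_)) (E , C) → Rep H σ E ⊥ C → σ stuck ≡ 0 →
    Star (H ⊢_⟶_) (⊤ , ⊤) (E , C) →
    Run H main-loop σ (loop-bound E) (λ τ → Outputs H (result τ))
  loop-run {σ} {E} {C} (acc rs) R z reach with nonempty? E | nonempty? (peelable H E)
  ... | no ∄E | _ = weaken (≤-trans (m≤m+n 5 _) (m≤n+m _ _)) id
    (while-exit halt (subst (Outputs H) (sym (result-just R z)) (_ , reach , success ∄E)))
    where
    halt : not (does (σ remaining ≟ 0)) ∧ does (σ stuck ≟ 0) ≡ false
    halt rewrite remaining≡ R | Empty-unique ∄E | ∣⊥∣≡0 m = refl
  ... | yes E≢∅ | no ∄F =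
    weaken (stuck-bound (p⊆q⇒∣p∣≤∣q∣ (degree-one⊆live {E})) (p⊆q⇒∣p∣≤∣q∣ (peelable⊆ H {E}))) id
      (while-step (continue R z E≢∅) (round-run R) λ where
        (_ , _ , inj₁ (_ , round _ F≢∅ _)) → contradiction F≢∅ ∄F
        {τ} (_ , R′ , inj₂ (o , _)) → while-exit (halt {τ} o)
          (subst (Outputs H) (sym (result-nothing {τ} o)) (_ , reach , failure E≢∅ ∄F)))
    where
    halt : ∀ {τ : Memory n m} → τ stuck ≡ 1 →
           not (does (τ remaining ≟ 0)) ∧ does (τ stuck ≟ 0) ≡ false
    halt {τ} o rewrite o with does (τ remaining ≟ 0)
    ... | true  = refl
    ... | false = refl
  ... | yes E≢∅ | yes (e , e∈F) with e∈E , v , v∈e , deg1 ← peelable⁻ H e∈F =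
    weaken (productive-bound _ (x∈p⇒0<∣p∣ {x = v} (∈⟪⟫⁺ (λ v → degree H E v ≟ 1) deg1))
                             (x∈p⇒0<∣p∣ e∈F) (live-peel E) (∣p─q∣+∣q∣≤∣p∣ E (peelable H E) (peelable⊆ H))) id
      (while-step (continue R z E≢∅) (round-run R) λ where
        (_ , R′ , inj₁ (z′ , r)) → loop-run (rs r) R′ z′ (reach ◅◅ (r ◅ ε))
        (_ , _ , inj₂ (_ , ∄F)) → contradiction (e , e∈F) ∄F)

  program-run : ∀ σ → Run H program σ (27 + 21 * n + 20 * m + 26 * (n * m))
                        (λ τ → Outputs H (result τ))
  program-run σ = weaken bound id
    (initialise-run H σ ⨾ʳ λ (R , z) → loop-run (terminates H) R z ε)
    where
    open ≤-Reasoning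
    total : ∀ n m → 1 + (9 + n * 4 + m * (9 + n * 4)) +
              (n * (14 + 15 * m) + m * (8 + 7 * n) + (17 + 3 * n + 3 * m)) ≡
              27 + 21 * n + 20 * m + 26 * (n * m)
    total = solve-∀
    bound : 1 + (9 + n * 4 + m * (9 + n * 4)) + loop-bound ⊤ ≤
            27 + 21 * n + 20 * m + 26 * (n * m)
    bound = begin
      1 + (9 + n * 4 + m * (9 + n * 4)) + loop-bound ⊤
        -- Initially there are at most n live vertices and at most m edges.
        ≤⟨ +-monoʳ-≤ (1 + (9 + n * 4 + m * (9 + n * 4)))
             (+-monoˡ-≤ (17 + 3 * n + 3 * m)
               (+-mono-≤ (*-monoˡ-≤ (14 + 15 * m) (∣p∣≤n (live ⊤)))
                         (*-monoˡ-≤ (8 + 7 * n) (∣p∣≤n {m} ⊤)))) ⟩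
      _ ≡⟨ total n m ⟩
      27 + 21 * n + 20 * m + 26 * (n * m) ∎

-- For positive n and m each of 1, n and m is at most n m, and 27 + 21 + 20 + 26 = 94. Positivity
-- matters: if n or m is 0 the product vanishes, yet the program still takes steps.
linear≤product : ∀ n m → 1 ≤ n → 1 ≤ m → 27 + 21 * n + 20 * m + 26 * (n * m) ≤ 94 * (n * m)
linear≤product (suc n) (suc m) _ _ = ≤-trans (m≤m+n _ _) (≤-reflexive (expand n m))
  where
  expand : ∀ n m → 27 + 21 * (1 + n) + 20 * (1 + m) + 26 * ((1 + n) * (1 + m)) +
             (47 * n + 48 * m + 68 * (n * m)) ≡ 94 * ((1 + n) * (1 + m))
  expand = solve-∀

theorem11 : (∀ (n m : ℕ) (H : Hypergraph n m) →
    Terminates H ×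
    (∀ (res : Maybe (Subset n)) → Outputs H res →
    (∃[ C ] res ≡ just C × IsOptimalCore[n-m] H C) ⇔ (∃[ C ] IsCore[n-m] H C)))
    ×
    (∃[ c ] ∀ (n m : ℕ) (H : Hypergraph n m) (σ : Memory n m) →
    ∃[ t ] ∃[ σ′ ]
    H ⊢ program , σ ⇓[ t ] σ′ ×
    Outputs H (result σ′) ×
    (1 ≤ n → 1 ≤ m → t ≤ c * (n * m)))
theorem11 =
  (λ n m H → terminates H , λ res out → mk⇔
    (λ (C , _ , core , _) → C , core) (output-optimal out)) ,
  94 , λ n m H σ → let run d t≤ out = program-run H σ in
    _ , _ , d , out , λ 1≤n 1≤m → ≤-trans t≤ (linear≤product n m 1≤n 1≤m)
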